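{- Let $q$ be a prime power and let $A$ be a finite subset of $\mathbb{F}_q^*$ with the property that $$|A\cap cG|\leq \max\left\{|G|^{1/2},\frac{|A|}{8}\right\}$$ for every subfield $G$ of $\mathbb{F}_q$ and every element $c\in\mathbb{F}_q$. Then either $$|A+A+A+A|^5|A:A|^4\gg |A|^{10},$$ or $$|A+A+A+A|^4|A:A|^5\gg |A|^{10}.$$ In particular, $$\max\{|A+A+A+A|,|A:A|\}\gg |A|^{10/9}.$$ Here the implied constants are absolute (independent of $q$ and $A$).
   Context: $A+A+A+A=\{a_1+a_2+a_3+a_4:a_i\in A\}$ is the fourfold sum set and $A:A=\{a/b:a,b\in A\}$ is the ratio set. For a subfield $G$ and $c\in\mathbb{F}_q$, $cG=\{cg:g\in G\}$. The notation $U\ll V$ (equivalently $V\gg U$) means $|U|\le cV$ for some absolute constant $c>0$. -}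

module Defs where

open import Data.Nat using (ℕ)
open import Data.Fin using (Fin)
open import Data.Fin.Subset using (Subset; _∈_; ∣_∣)
open import Data.Fin.Subset.Properties using (_∈?_)
open import Data.Fin.Properties using (any?)
open import Data.Vec using (tabulate)
open import Data.Product using (Σ; _×_; _,_)
open import Relation.Nullary using (¬_; does)
open import Relation.Nullary.Decidable using (_×-dec_)
open import Relation.Binary.PropositionalEquality using (_≡_)
open import Data.Fin.Properties using () renaming (_≟_ to _≟F_)
open import Algebra.Structures using (IsCommutativeRing)

-- A finite field with q elements, carried (without loss of generality) by Fin q,
-- with propositional equality.  The inverse is a total operation whose value
-- at 0 is irrelevant.
record FiniteField (q : ℕ) : Set where
  field
    _+_ _*_ : Fin q → Fin q → Fin q
    -_ _⁻¹  : Fin q → Fin q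
    0# 1#   : Fin q
    isCommutativeRing : IsCommutativeRing _≡_ _+_ _*_ -_ 0# 1#
    0≢1     : ¬ (0# ≡ 1#)
    inverseʳ : ∀ x → ¬ (x ≡ 0#) → x * (x ⁻¹) ≡ 1#

module _ {q : ℕ} (F : FiniteField q) where
  open FiniteField F

  record IsSubfield (G : Subset q) : Set where
    field
      zero∈ : 0# ∈ G
      one∈  : 1# ∈ G
      +-closed : ∀ {x y} → x ∈ G → y ∈ G → (x + y) ∈ G
      *-closed : ∀ {x y} → x ∈ G → y ∈ G → (x * y) ∈ G
      neg-closed : ∀ {x} → x ∈ G → (- x) ∈ G
      inv-closed : ∀ {x} → x ∈ G → ¬ (x ≡ 0#) → (x ⁻¹) ∈ G

  NonzeroSet : Subset q → Set
  NonzeroSet A = ¬ (0# ∈ A)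

  _∩scaled_,_ : Subset q → Fin q → Subset q → Subset q
  A ∩scaled c , G = tabulate λ x →
    does ((x ∈? A) ×-dec any? (λ g → (g ∈? G) ×-dec (x ≟F (c * g))))

  fourfoldSum : Subset q → Subset q
  fourfoldSum A = tabulate λ x →
    does (any? λ a₁ → any? λ a₂ → any? λ a₃ → any? λ a₄ →
      (a₁ ∈? A) ×-dec (a₂ ∈? A) ×-dec (a₃ ∈? A) ×-dec (a₄ ∈? A) ×-dec
      (x ≟F (((a₁ + a₂) + a₃) + a₄)))

  ratioSet : Subset q → Subset q
  ratioSet A = tabulate λ x →
    does (any? λ a → any? λ b →
      (a ∈? A) ×-dec (b ∈? A) ×-dec (x ≟F (a * (b ⁻¹))))

{-# OPTIONS --safe #-}
module Submission where

open import Defs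
open import Algebra using (CommutativeRing)
import Algebra.Properties.Group as GroupProperties
import Algebra.Properties.Ring as RingProperties
import Algebra.Solver.Ring.NaturalCoefficients.Default as SemiringSolver
open import Data.Bool using (if_then_else_)
open import Data.Empty using (⊥-elim)
open import Data.Fin using (Fin; zero; suc)
import Data.Fin.Properties as Fin
open import Data.Fin.Subset using (Subset; ∣_∣; inside; outside) renaming (_∈_ to _∈ˢ_)
import Data.Fin.Subset.Properties as Subset
open import Data.List using (List; []; _∷_; _++_; length; map; filter; cartesianProduct; allFin)
open import Data.List.Properties using (length-map; length-++; map-++; map-cong; map-∘; map-tabulate)
open import Data.List.Membership.Propositional using (_∈_; find)
open import Data.List.Membership.Propositional.Properties using (∈-map⁺; ∈-map⁻; ∈-∃++; ∈-++⁺ʳ; ∈-filter⁺; ∈-filter⁻; ∈-cartesianProduct⁻; ∈-allFin)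
import Data.List.Membership.DecPropositional as DecMembership
open import Data.List.Relation.Binary.Permutation.Propositional using (_↭_; ↭-trans; ↭-refl; ↭-sym; ↭⇒↭ₛ; prep)
open import Data.List.Relation.Binary.Permutation.Propositional.Properties using (map⁺; shift; ↭-length; ∈-resp-↭)
import Data.List.Relation.Binary.Permutation.Setoid.Properties as PermutationSetoid
import Data.List.Relation.Unary.All as All
open import Data.List.Relation.Unary.All.Properties using (¬All⇒Any¬)
import Data.List.Relation.Unary.AllPairs as AllPairs
open import Data.List.Relation.Unary.AllPairs using ([]; _∷_)
open import Data.List.Relation.Unary.Any using (here; there)
open import Data.List.Relation.Unary.Unique.Propositional using (Unique)
import Data.List.Relation.Unary.Unique.Propositional.Properties as Unique
open import Data.Nat using (ℕ; zero; suc; _+_; _*_; _^_; _⊔_; _≤_; _<_; z≤n; s≤s; NonZero; >-nonZero)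
open import Data.Nat.ListAction using (sum)
open import Data.Nat.ListAction.Properties using (sum-++; sum-↭)
open import Data.Nat.Properties hiding (_≟_)
open import Data.Nat.Solver using (module +-*-Solver)
open import Data.Product using (Σ; ∃; _×_; _,_; proj₁; proj₂)
open import Data.Product.Properties using (≡-dec)
open import Data.Sum using (_⊎_; inj₁; inj₂)
import Data.Vec as Vec
import Data.Vec.Properties as Vec
open import Function using (_∘_; id)
open import Relation.Binary using (DecidableEquality)
open import Relation.Binary.PropositionalEquality using (_≡_; _≢_; refl; sym; trans; cong; cong₂; subst; setoid; module ≡-Reasoning)
open import Relation.Nullary using (¬_; Dec; yes; no; does)
open import Relation.Nullary.Decidable using (_×-dec_; _→-dec_; ¬?; decidable-stable)
open import Relation.Unary using (Decidable)

-- Choose x₀ ∈ A such that most u ∈ A have |A ∩ (u/x₀)A| ≫ |A|²/|A:A|, and delete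
-- low-degree vertices from the graph xy ∈ x₀A.  After rescaling by x₀ this leaves B ⊆ A
-- with |B| ≥ |A|/2 such that every b ∈ B has at least d ≫ |A|²/|A:A| elements x ∈ B with bx ∈ A.
--
-- Let Λ be the set of slopes (a − b)/(c − d) with a, b, c, d ∈ B.  If ρ ∉ Λ, then (x, y) ↦ x + ρy
-- is injective on B × B.  In the cases below, multiplying by the denominator of r turns it into
-- a sum of four terms ± β h with β ∈ B and h one of x, y, x + y, by.  An energy argument
-- restricts each term to a translate of A, keeping a proportion d/|4A| of the pairs; at the
-- end the injective image lies in a translate of 4A.
--   * ρ = 1 + r with r ∈ Λ: four restrictions of B × B give |B|² d⁴ ≤ |4A|⁵.
--   * ρ = br with r ∈ Λ, b ∈ B: start from d² pairs with cx ∈ A and by ∈ A; three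
--     restrictions give d⁵ ≤ |4A|⁴.
--   * Otherwise Λ is stable under 1 + · and under multiplication by B.  The multipliers of
--     the group of additive periods of Λ then form a subfield G with B ⊆ G ⊆ Λ, so that
--     |B|² ≤ |G| by hypothesis; averaging the energy over r ∈ G yields a slope r for which
--     x + ry takes at least |B|²/2 values, and four restrictions apply again.

private variable
  X Y : Set

-- Finite sums and double counting

𝟙 : {P : Set} → Dec P → ℕ
𝟙 d = if does d then 1 else 0

𝟙-mono : {P Q : Set} (p : Dec P) (q : Dec Q) → (P → Q) → 𝟙 p ≤ 𝟙 q
𝟙-mono (no _)  _       _ = z≤n
𝟙-mono (yes _) (yes _) _ = ≤-refl
𝟙-mono (yes p) (no ¬q) f = ⊥-elim (¬q (f p))

𝟙-yes : {P : Set} (p : Dec P) → P → 1 ≤ 𝟙 p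
𝟙-yes p x = 𝟙-mono (yes x) p id

∑ : List X → (X → ℕ) → ℕ
∑ xs f = sum (map f xs)

∑-mono : (xs : List X) {f g : X → ℕ} → (∀ {x} → x ∈ xs → f x ≤ g x) → ∑ xs f ≤ ∑ xs g
∑-mono []       _ = z≤n
∑-mono (x ∷ xs) h = +-mono-≤ (h (here refl)) (∑-mono xs (h ∘ there))

∑-cong : (xs : List X) {f g : X → ℕ} → (∀ x → f x ≡ g x) → ∑ xs f ≡ ∑ xs g
∑-cong xs h = cong sum (map-cong h xs)

∑-const : (xs : List X) (c : ℕ) → ∑ xs (λ _ → c) ≡ length xs * c
∑-const []       c = refl
∑-const (x ∷ xs) c = cong (c +_) (∑-const xs c)

∑-+ : (xs : List X) (f g : X → ℕ) → ∑ xs (λ x → f x + g x) ≡ ∑ xs f + ∑ xs g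
∑-+ []       f g = refl
∑-+ (x ∷ xs) f g rewrite ∑-+ xs f g =
  solve 4 (λ a b c d → a :+ b :+ (c :+ d) := a :+ c :+ (b :+ d)) refl (f x) (g x) (∑ xs f) (∑ xs g)
  where open +-*-Solver

∑-*ˡ : (xs : List X) (c : ℕ) (f : X → ℕ) → ∑ xs (λ x → c * f x) ≡ c * ∑ xs f
∑-*ˡ []       c f = sym (*-zeroʳ c)
∑-*ˡ (x ∷ xs) c f rewrite ∑-*ˡ xs c f = sym (*-distribˡ-+ c (f x) (∑ xs f))

∑-swap : (xs : List X) (ys : List Y) (f : X → Y → ℕ) →
         ∑ xs (λ x → ∑ ys (f x)) ≡ ∑ ys (λ y → ∑ xs (λ x → f x y))
∑-swap []       ys f = sym (trans (∑-const ys 0) (*-zeroʳ (length ys)))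
∑-swap (x ∷ xs) ys f rewrite ∑-swap xs ys f = sym (∑-+ ys (f x) (λ y → ∑ xs (λ x → f x y)))

∑-++ : (xs ys : List X) (f : X → ℕ) → ∑ (xs ++ ys) f ≡ ∑ xs f + ∑ ys f
∑-++ xs ys f rewrite map-++ f xs ys = sum-++ (map f xs) (map f ys)

∑-map : (g : X → Y) (xs : List X) (f : Y → ℕ) → ∑ (map g xs) f ≡ ∑ xs (f ∘ g)
∑-map g xs f = cong sum (sym (map-∘ xs))

∑-↭ : {xs ys : List X} → xs ↭ ys → (f : X → ℕ) → ∑ xs f ≡ ∑ ys f
∑-↭ p f = sum-↭ (map⁺ f p)

∑-cartesianProduct : (xs : List X) (ys : List Y) (f : X × Y → ℕ) →
                     ∑ (cartesianProduct xs ys) f ≡ ∑ xs (λ x → ∑ ys (λ y → f (x , y)))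
∑-cartesianProduct []       ys f = refl
∑-cartesianProduct (x ∷ xs) ys f = trans (∑-++ (map (x ,_) ys) (cartesianProduct xs ys) f)
  (cong₂ _+_ (∑-map (x ,_) ys f) (∑-cartesianProduct xs ys f))

∑-1 : (xs : List X) → ∑ xs (λ _ → 1) ≡ length xs
∑-1 xs = trans (∑-const xs 1) (*-identityʳ (length xs))

length-cartesianProduct : (xs : List X) (ys : List Y) → length (cartesianProduct xs ys) ≡ length xs * length ys
length-cartesianProduct xs ys = trans (sym (∑-1 (cartesianProduct xs ys)))
  (trans (∑-cartesianProduct xs ys _) (trans (∑-cong xs (λ _ → ∑-1 ys)) (∑-const xs (length ys))))

length-filter≡∑ : {P : X → Set} (P? : Decidable P) (xs : List X) → length (filter P? xs) ≡ ∑ xs (𝟙 ∘ P?)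
length-filter≡∑ P? []       = refl
length-filter≡∑ P? (x ∷ xs) with P? x
... | yes _ = cong suc (length-filter≡∑ P? xs)
... | no _  = length-filter≡∑ P? xs

∑-member : (xs : List X) (f : X → ℕ) {x : X} → x ∈ xs → f x ≤ ∑ xs f
∑-member (x ∷ xs) f (here refl) = m≤m+n (f x) _
∑-member (x ∷ xs) f (there p)   = ≤-trans (∑-member xs f p) (m≤n+m _ (f x))

∑-≤-argmax : (xs : List X) (f : X → ℕ) →
             length xs ≡ 0 ⊎ ∃ λ y → y ∈ xs × ∑ xs f ≤ length xs * f y
∑-≤-argmax []       f = inj₁ refl
∑-≤-argmax (x ∷ xs) f with ∑-≤-argmax xs f
... | inj₁ e with [] ← xs = inj₂ (x , here refl , ≤-refl)
... | inj₂ (y , y∈ , le) with ≤-total (f x) (f y)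
... | inj₁ fx≤fy = inj₂ (y , there y∈ , +-mono-≤ fx≤fy le)
... | inj₂ fy≤fx = inj₂ (x , here refl , +-monoʳ-≤ (f x) (≤-trans le (*-monoʳ-≤ (length xs) fy≤fx)))

argmin-≤-∑ : (xs : List X) (f : X → ℕ) →
             length xs ≡ 0 ⊎ ∃ λ y → y ∈ xs × length xs * f y ≤ ∑ xs f
argmin-≤-∑ []       f = inj₁ refl
argmin-≤-∑ (x ∷ xs) f with argmin-≤-∑ xs f
... | inj₁ e with [] ← xs = inj₂ (x , here refl , ≤-refl)
... | inj₂ (y , y∈ , le) with ≤-total (f x) (f y)
... | inj₂ fy≤fx = inj₂ (y , there y∈ , +-mono-≤ fy≤fx le)
... | inj₁ fx≤fy = inj₂ (x , here refl , +-monoʳ-≤ (f x) (≤-trans (*-monoʳ-≤ (length xs) fx≤fy) le))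

m*m≤m*k⇒m≤k : ∀ {m k} → m * m ≤ m * k → m ≤ k
m*m≤m*k⇒m≤k {zero}  _ = z≤n
m*m≤m*k⇒m≤k {suc m} h = *-cancelˡ-≤ (suc m) h

2ab≤a²+b² : ∀ a b → 2 * (a * b) ≤ a * a + b * b
2ab≤a²+b² a b with ≤-total a b
... | inj₁ a≤b with m≤n⇒∃[o]m+o≡n a≤b
... | k , refl = ≤-trans (m≤m+n _ (k * k)) (≤-reflexive
  (solve 2 (λ a k → con 2 :* (a :* (a :+ k)) :+ k :* k := a :* a :+ (a :+ k) :* (a :+ k)) refl a k))
  where open +-*-Solver
2ab≤a²+b² a b | inj₂ b≤a with m≤n⇒∃[o]m+o≡n b≤a
... | k , refl = ≤-trans (m≤m+n _ (k * k)) (≤-reflexive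
  (solve 2 (λ b k → con 2 :* ((b :+ k) :* b) :+ k :* k := (b :+ k) :* (b :+ k) :+ b :* b) refl b k))
  where open +-*-Solver

∑-amgm : (a : ℕ) (xs : List X) (f : X → ℕ) →
         2 * (a * ∑ xs f) ≤ length xs * (a * a) + ∑ xs (λ x → f x * f x)
∑-amgm a xs f = begin
  2 * (a * ∑ xs f)                                  ≡⟨ cong (2 *_) (∑-*ˡ xs a f) ⟨
  2 * ∑ xs (λ x → a * f x)                          ≡⟨ ∑-*ˡ xs 2 _ ⟨
  ∑ xs (λ x → 2 * (a * f x))                        ≤⟨ ∑-mono xs (λ {x} _ → 2ab≤a²+b² a (f x)) ⟩
  ∑ xs (λ x → a * a + f x * f x)                    ≡⟨ ∑-+ xs (λ _ → a * a) _ ⟩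
  ∑ xs (λ _ → a * a) + ∑ xs (λ x → f x * f x)       ≡⟨ cong (_+ ∑ xs (λ x → f x * f x)) (∑-const xs (a * a)) ⟩
  length xs * (a * a) + ∑ xs (λ x → f x * f x)      ∎
  where open ≤-Reasoning

cauchySchwarz : (xs : List X) (f : X → ℕ) → ∑ xs f * ∑ xs f ≤ length xs * ∑ xs (λ x → f x * f x)
cauchySchwarz []       f = z≤n
cauchySchwarz (x ∷ xs) f = begin
  (a + s) * (a + s)                    ≡⟨ solve 2 (λ a s → (a :+ s) :* (a :+ s) := a :* a :+ con 2 :* (a :* s) :+ s :* s) refl a s ⟩
  a * a + 2 * (a * s) + s * s          ≤⟨ +-mono-≤ (+-monoʳ-≤ (a * a) (∑-amgm a xs f)) (cauchySchwarz xs f) ⟩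
  a * a + (l * (a * a) + t) + l * t    ≡⟨ solve 3 (λ a l t → a :* a :+ (l :* (a :* a) :+ t) :+ l :* t := (con 1 :+ l) :* (a :* a :+ t)) refl a l t ⟩
  suc l * (a * a + t)                  ∎
  where
  open ≤-Reasoning
  open +-*-Solver
  a = f x
  s = ∑ xs f
  t = ∑ xs (λ x → f x * f x)
  l = length xs

-- At most one entry satisfies `P`, so the count is 0 or 1, and a count of 1 comes with a proof of
-- `D`. Bounding by the indicator of `D` rather than by 1 lets a fibre count be summed again over
-- outer variables.
∑-unique-≤ : {P : X → Set} (P? : Decidable P) {D : Set} (D? : Dec D) {xs : List X} → Unique xs →
             (∀ {x y} → x ∈ xs → y ∈ xs → P x → P y → x ≡ y) →
             (∀ {x} → x ∈ xs → P x → D) → ∑ xs (𝟙 ∘ P?) ≤ 𝟙 D?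
∑-unique-≤ P? D? [] _ _ = z≤n
∑-unique-≤ P? D? {x ∷ xs} (x∉ ∷ u) inj imp with P? x
... | no _  = ∑-unique-≤ P? D? u (λ p q → inj (there p) (there q)) (imp ∘ there)
-- After the witness `x` no further entry satisfies `P`; taking the empty type for `D` makes the
-- count over the tail 0.
... | yes p = ≤-trans (s≤s (∑-unique-≤ P? (no id) u (λ p q → inj (there p) (there q))
    (λ y∈ q → All.lookup x∉ y∈ (inj (here refl) (there y∈) p q))))
  (𝟙-yes D? (imp (here refl) p))

-- Double counting of the pairs with `φ x ≡ y`: each `x` gives at least one, each entry `y` of `ys`
-- at most one.
injection⇒length-≤ : DecidableEquality Y → {xs : List X} → Unique xs → (ys : List Y) (φ : X → Y) →
                     (∀ {x x′} → x ∈ xs → x′ ∈ xs → φ x ≡ φ x′ → x ≡ x′) →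
                     (∀ {x} → x ∈ xs → φ x ∈ ys) → length xs ≤ length ys
injection⇒length-≤ _≟_ {xs} u ys φ inj into = begin
  length xs                                  ≡⟨ ∑-1 xs ⟨
  ∑ xs (λ _ → 1)                             ≤⟨ ∑-mono xs (λ {x} x∈ → ≤-trans (𝟙-yes (φ x ≟ φ x) refl)
                                                  (∑-member ys (λ y → 𝟙 (φ x ≟ y)) (into x∈))) ⟩
  ∑ xs (λ x → ∑ ys (λ y → 𝟙 (φ x ≟ y)))      ≡⟨ ∑-swap xs ys _ ⟩
  ∑ ys (λ y → ∑ xs (λ x → 𝟙 (φ x ≟ y)))      ≤⟨ ∑-mono ys (λ {y} _ → ∑-unique-≤ (λ x → φ x ≟ y) (yes refl) u
                                                  (λ p q e e′ → inj p q (trans e (sym e′))) (λ _ _ → refl {x = y})) ⟩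
  ∑ ys (λ _ → 1)                             ≡⟨ ∑-1 ys ⟩
  length ys                                  ∎
  where open ≤-Reasoning

-- One representative per value of `φ`: entries on which `φ` is injective, without losing a value.
-- With `φ = id` this discards repetitions.
record Transversal (_≟_ : DecidableEquality Y) (φ : X → Y) (xs : List X) : Set where
  field
    reps       : List X
    reps⊆      : ∀ {x} → x ∈ reps → x ∈ xs
    map-unique : Unique (map φ reps)
    covers     : ∀ {x} → x ∈ xs → φ x ∈ map φ reps
    length-≤   : length reps ≤ length xs

transversal : (_≟_ : DecidableEquality Y) (φ : X → Y) (xs : List X) → Transversal _≟_ φ xs
transversal _≟_ φ [] = record
  { reps = [] ; reps⊆ = λ () ; map-unique = [] ; covers = λ () ; length-≤ = z≤n }
transversal _≟_ φ (x ∷ xs) with transversal _≟_ φ xs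
... | t with DecMembership._∈?_ _≟_ (φ x) (map φ (Transversal.reps t))
... | yes φx∈ = record
  { reps = reps ; reps⊆ = there ∘ reps⊆ ; map-unique = map-unique
  ; covers = λ { (here refl) → φx∈ ; (there p) → covers p } ; length-≤ = m≤n⇒m≤1+n length-≤ }
  where open Transversal t
... | no φx∉ = record
  { reps = x ∷ reps ; reps⊆ = λ { (here refl) → here refl ; (there p) → there (reps⊆ p) }
  ; map-unique = All.tabulate (λ { y∈ refl → φx∉ y∈ }) ∷ map-unique
  ; covers = λ { (here refl) → here refl ; (there p) → there (covers p) } ; length-≤ = s≤s length-≤ }
  where open Transversal t

-- Ordered pairs with equal image, the diagonal included. For an addition map `g` this is the
-- additive energy.
collisions : DecidableEquality Y → (X → Y) → List X → ℕ
collisions _≟_ g xs = ∑ xs (λ x → ∑ xs (λ y → 𝟙 (g x ≟ g y)))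

-- Cauchy-Schwarz for the fibre sizes `w z`: they add up to at least `length xs`, and, `zs` having
-- no repetitions, their squares add up to at most the number of collisions.
length²≤unique-collisions : (_≟_ : DecidableEquality Y) (g : X → Y) (xs : List X) {zs : List Y} → Unique zs →
                     (∀ {x} → x ∈ xs → g x ∈ zs) →
                     length xs * length xs ≤ length zs * collisions _≟_ g xs
length²≤unique-collisions _≟_ g xs {zs} u into = begin
  length xs * length xs                      ≤⟨ *-mono-≤ fibres fibres ⟩
  ∑ zs w * ∑ zs w                            ≤⟨ cauchySchwarz zs w ⟩
  length zs * ∑ zs (λ z → w z * w z)         ≡⟨ cong (length zs *_) (∑-cong zs λ z → square z) ⟩
  length zs * ∑ zs (λ z → ∑ xs (λ x → ∑ xs (λ y → 𝟙 (g x ≟ z) * 𝟙 (g y ≟ z))))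
                                             ≡⟨ cong (length zs *_) (trans (∑-swap zs xs _) (∑-cong xs λ x → ∑-swap zs xs _)) ⟩
  length zs * ∑ xs (λ x → ∑ xs (λ y → ∑ zs (λ z → 𝟙 (g x ≟ z) * 𝟙 (g y ≟ z))))
                                             ≤⟨ *-monoʳ-≤ (length zs) (∑-mono xs λ {x} _ → ∑-mono xs λ {y} _ → meet x y) ⟩
  length zs * collisions _≟_ g xs            ∎
  where
  open ≤-Reasoning
  w = λ z → ∑ xs (λ x → 𝟙 (g x ≟ z))
  fibres : length xs ≤ ∑ zs w
  fibres = ≤-trans (≤-reflexive (sym (∑-1 xs))) (≤-trans
    (∑-mono xs (λ {x} x∈ → ≤-trans (𝟙-yes (g x ≟ g x) refl) (∑-member zs (λ z → 𝟙 (g x ≟ z)) (into x∈))))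
    (≤-reflexive (∑-swap xs zs _)))
  square : ∀ z → w z * w z ≡ ∑ xs (λ x → ∑ xs (λ y → 𝟙 (g x ≟ z) * 𝟙 (g y ≟ z)))
  square z = trans (sym (∑-*ˡ xs (w z) _)) (trans
    (∑-cong xs λ x → trans (*-comm (w z) _) (sym (∑-*ˡ xs (𝟙 (g x ≟ z)) _))) refl)
  product-≤ : ∀ x y z → 𝟙 (g x ≟ z) * 𝟙 (g y ≟ z) ≤ 𝟙 ((g x ≟ z) ×-dec (g y ≟ z))
  product-≤ x y z with g x ≟ z | g y ≟ z
  ... | yes _ | yes _ = ≤-refl
  ... | yes _ | no _  = z≤n
  ... | no _  | _     = z≤n
  meet : ∀ x y → ∑ zs (λ z → 𝟙 (g x ≟ z) * 𝟙 (g y ≟ z)) ≤ 𝟙 (g x ≟ g y)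
  meet x y = ≤-trans (∑-mono zs (λ {z} _ → product-≤ x y z))
    (∑-unique-≤ (λ z → (g x ≟ z) ×-dec (g y ≟ z)) (g x ≟ g y) u
      (λ _ _ p q → trans (sym (proj₁ p)) (proj₁ q)) (λ _ p → trans (proj₁ p) (sym (proj₂ p))))

length²≤collisions : (_≟_ : DecidableEquality Y) (g : X → Y) (xs : List X) (zs : List Y) →
              (∀ {x} → x ∈ xs → g x ∈ zs) → length xs * length xs ≤ length zs * collisions _≟_ g xs
length²≤collisions _≟_ g xs zs into = ≤-trans
  (length²≤unique-collisions _≟_ g xs map-unique (covers ∘ into))
  (*-monoˡ-≤ (collisions _≟_ g xs) (≤-trans (≤-reflexive (length-map id reps)) length-≤))
  where open Transversal (transversal _≟_ id zs)

-- Peeling off vertices of small degree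

edges : (X → X → ℕ) → List X → ℕ
edges adj xs = ∑ xs (λ x → ∑ xs (adj x))

edges-↭ : (adj : X → X → ℕ) {xs ys : List X} → xs ↭ ys → edges adj xs ≡ edges adj ys
edges-↭ adj {xs} p = trans (∑-cong xs λ x → ∑-↭ p (adj x)) (∑-↭ p _)

-- Denominators are cleared: the degree threshold is `Q / (2P)`, and by `edges-≤` a removed vertex
-- costs on average at most `Q / P` in the ordered edge count.
record Core (adj : X → X → ℕ) (P Q : ℕ) (xs : List X) : Set where
  field
    removed core : List X
    split        : xs ↭ removed ++ core
    degree       : ∀ {x} → x ∈ core → Q ≤ 2 * (P * ∑ core (adj x))
    edges-≤      : P * edges adj xs ≤ P * edges adj core + length removed * Q

-- By symmetry the row and the column of `x` contribute equally; counting the diagonal entry twice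
-- only weakens the bound.
edges-∷ : (adj : X → X → ℕ) → (∀ x y → adj x y ≡ adj y x) → (x : X) (xs : List X) →
          edges adj (x ∷ xs) ≤ 2 * ∑ (x ∷ xs) (adj x) + edges adj xs
edges-∷ adj adj-sym x xs = begin
  adj x x + r + ∑ xs (λ y → adj y x + ∑ xs (adj y))      ≡⟨ cong (adj x x + r +_) (∑-+ xs (λ y → adj y x) _) ⟩
  adj x x + r + (∑ xs (λ y → adj y x) + edges adj xs)    ≡⟨ cong (λ k → adj x x + r + (k + edges adj xs)) (∑-cong xs (λ y → adj-sym y x)) ⟩
  adj x x + r + (r + edges adj xs)                       ≤⟨ m≤m+n _ (adj x x) ⟩
  adj x x + r + (r + edges adj xs) + adj x x             ≡⟨ solve 3 (λ a r e → a :+ r :+ (r :+ e) :+ a := con 2 :* (a :+ r) :+ e) refl (adj x x) r (edges adj xs) ⟩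
  2 * (adj x x + r) + edges adj xs                       ∎
  where
  open ≤-Reasoning
  open +-*-Solver
  r = ∑ xs (adj x)

-- Delete a vertex of degree below `Q / (2P)` as long as there is one; by `edges-∷` it takes away at
-- most twice its degree. The bound `k` on the length makes the recursion structural.
peel : (adj : X → X → ℕ) → (∀ x y → adj x y ≡ adj y x) → (P Q : ℕ) →
       (k : ℕ) (xs : List X) → length xs ≤ k → Core adj P Q xs
peel adj adj-sym P Q k [] _ = record
  { removed = [] ; core = [] ; split = ↭-refl ; degree = λ () ; edges-≤ = m≤m+n _ _ }
peel {X} adj adj-sym P Q (suc k) xs@(_ ∷ _) len with All.all? (λ x → Q ≤? 2 * (P * ∑ xs (adj x))) xs
... | yes good = record
  { removed = [] ; core = xs ; split = ↭-refl ; degree = All.lookup good ; edges-≤ = m≤m+n _ _ }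
... | no bad with find (¬All⇒Any¬ (λ x → Q ≤? 2 * (P * ∑ xs (adj x))) xs bad)
... | x , x∈ , low with ∈-∃++ x∈
... | ys , zs , eq = record
  { removed = x ∷ removed
  ; core    = core
  ; split   = ↭-trans xs↭ (prep x split)
  ; degree  = degree
  ; edges-≤ = begin
      P * edges adj xs                                                ≡⟨ cong (P *_) (edges-↭ adj xs↭) ⟩
      P * edges adj (x ∷ rest)                                        ≤⟨ *-monoʳ-≤ P (edges-∷ adj adj-sym x rest) ⟩
      P * (2 * ∑ (x ∷ rest) (adj x) + edges adj rest)                 ≡⟨ cong (λ d → P * (2 * d + edges adj rest)) (∑-↭ xs↭ (adj x)) ⟨
      P * (2 * ∑ xs (adj x) + edges adj rest)                         ≡⟨ solve 3 (λ p d e → p :* (con 2 :* d :+ e) := con 2 :* (p :* d) :+ p :* e) refl P (∑ xs (adj x)) (edges adj rest) ⟩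
      2 * (P * ∑ xs (adj x)) + P * edges adj rest                     ≤⟨ +-mono-≤ (<⇒≤ (≰⇒> low)) edges-≤ ⟩
      Q + (P * edges adj core + length removed * Q)                   ≡⟨ solve 3 (λ q e l → q :+ (e :+ l) := e :+ (q :+ l)) refl Q (P * edges adj core) (length removed * Q) ⟩
      P * edges adj core + (Q + length removed * Q)                   ∎ }
  where
  open ≤-Reasoning
  open +-*-Solver
  rest : List X
  rest = ys ++ zs
  xs↭ : xs ↭ x ∷ rest
  xs↭ = subst (_↭ x ∷ rest) (sym eq) (shift x ys zs)
  open Core (peel adj adj-sym P Q k rest (≤-pred (subst (_≤ suc k) (↭-length xs↭) len)))

-- Peeling destroys few edges, so the degrees of the removed vertices `W` sum to at most
-- `|W| Q / P`. All but at most `u` of them have degree at least `2Q / P`, whence `2|W| ≤ |W| + 2u`.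
removed-≤ : (adj : X → X → ℕ) (P Q : ℕ) {{_ : NonZero Q}} {xs : List X} (c : Core adj P Q xs) →
            length (Core.removed c) ≤ 2 * ∑ xs (λ x → 𝟙 (P * ∑ xs (adj x) <? 2 * Q))
removed-≤ adj P Q {xs} c = *-cancelʳ-≤ (length W) (2 * u) Q (+-cancelˡ-≤ (length W * Q) _ _ (begin
  length W * Q + length W * Q                                  ≡⟨ solve 2 (λ w q → w :* q :+ w :* q := w :* (con 2 :* q)) refl (length W) Q ⟩
  length W * (2 * Q)                                           ≡⟨ ∑-const W (2 * Q) ⟨
  ∑ W (λ _ → 2 * Q)                                            ≤⟨ ∑-mono W (λ {x} _ → low-or-high (low? x)) ⟩
  ∑ W (λ x → P * deg x + 2 * Q * 𝟙 (low? x))                   ≡⟨ ∑-+ W _ _ ⟩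
  ∑ W (λ x → P * deg x) + ∑ W (λ x → 2 * Q * 𝟙 (low? x))       ≡⟨ cong₂ _+_ (∑-*ˡ W P deg) (∑-*ˡ W (2 * Q) _) ⟩
  P * ∑ W deg + 2 * Q * ∑ W (𝟙 ∘ low?)                         ≤⟨ +-mono-≤ removed-edges (*-monoʳ-≤ (2 * Q) low-removed) ⟩
  length W * Q + 2 * Q * u                                     ≡⟨ cong (length W * Q +_) (solve 2 (λ q u → con 2 :* q :* u := con 2 :* u :* q) refl Q u) ⟩
  length W * Q + 2 * u * Q                                     ∎))
  where
  open ≤-Reasoning
  open +-*-Solver
  open Core c renaming (removed to W; core to C)
  deg = λ x → ∑ xs (adj x)
  low? = λ x → P * deg x <? 2 * Q
  u = ∑ xs (𝟙 ∘ low?)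
  low-or-high : ∀ {p} (low : Dec (p < 2 * Q)) → 2 * Q ≤ p + 2 * Q * 𝟙 low
  low-or-high {p} (yes _)   = ≤-trans (≤-reflexive (sym (*-identityʳ (2 * Q)))) (m≤n+m _ p)
  low-or-high {p} (no high) = ≤-trans (≮⇒≥ high) (m≤m+n _ _)
  low-removed : ∑ W (𝟙 ∘ low?) ≤ u
  low-removed = ≤-trans (m≤m+n _ _) (≤-reflexive (trans (sym (∑-++ W C _)) (sym (∑-↭ split _))))
  removed-edges : P * ∑ W deg ≤ length W * Q
  removed-edges = +-cancelˡ-≤ (P * edges adj C) _ _ (begin
    P * edges adj C + P * ∑ W deg        ≤⟨ +-monoˡ-≤ _ (*-monoʳ-≤ P (∑-mono C λ {x} _ →
                                              ≤-trans (m≤n+m _ _) (≤-reflexive (trans (sym (∑-++ W C _)) (sym (∑-↭ split _)))))) ⟩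
    P * ∑ C deg + P * ∑ W deg            ≡⟨ solve 3 (λ p c w → p :* c :+ p :* w := p :* (w :+ c)) refl P (∑ C deg) (∑ W deg) ⟩
    P * (∑ W deg + ∑ C deg)              ≡⟨ cong (P *_) (trans (sym (∑-++ W C deg)) (sym (∑-↭ split deg))) ⟩
    P * edges adj xs                     ≤⟨ edges-≤ ⟩
    P * edges adj C + length W * Q       ∎)

-- Subsets of `Fin n` as duplicate-free lists

elements : ∀ {n} → Subset n → List (Fin n)
elements p = filter (Subset._∈? p) (allFin _)

elements-unique : ∀ {n} (p : Subset n) → Unique (elements p)
elements-unique p = Unique.filter⁺ (Subset._∈? p) (Unique.allFin⁺ _)

∈-elements⁺ : ∀ {n} {p : Subset n} {x} → x ∈ˢ p → x ∈ elements p
∈-elements⁺ {p = p} {x} x∈p = ∈-filter⁺ (Subset._∈? p) (∈-allFin x) x∈p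

∈-elements⁻ : ∀ {n} {p : Subset n} {x} → x ∈ elements p → x ∈ˢ p
∈-elements⁻ {p = p} x∈ = proj₂ (∈-filter⁻ (Subset._∈? p) {xs = allFin _} x∈)

∑-allFin-suc : ∀ n (f : Fin (suc n) → ℕ) → ∑ (allFin (suc n)) f ≡ f zero + ∑ (allFin n) (f ∘ suc)
∑-allFin-suc n f = cong (f zero +_) (trans (cong (λ xs → ∑ xs f) (sym (map-tabulate id suc))) (∑-map suc (allFin n) f))

∑-indicator : ∀ {n} (p : Subset n) → ∑ (allFin n) (𝟙 ∘ (Subset._∈? p)) ≡ ∣ p ∣
∑-indicator Vec.[] = refl
∑-indicator {suc n} (inside Vec.∷ p)  = trans (∑-allFin-suc n (𝟙 ∘ (Subset._∈? (inside Vec.∷ p)))) (cong suc (∑-indicator p))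
∑-indicator {suc n} (outside Vec.∷ p) = trans (∑-allFin-suc n (𝟙 ∘ (Subset._∈? (outside Vec.∷ p)))) (∑-indicator p)

length-elements : ∀ {n} (p : Subset n) → length (elements p) ≡ ∣ p ∣
length-elements p = trans (length-filter≡∑ (Subset._∈? p) (allFin _)) (∑-indicator p)

∈-tabulate⁺ : ∀ {n} {P : Fin n → Set} (P? : Decidable P) {x} → P x → x ∈ˢ Vec.tabulate (does ∘ P?)
∈-tabulate⁺ P? {x} p with P? x in eq
... | yes _ = Vec.lookup⇒[]= x _ (trans (Vec.lookup∘tabulate (does ∘ P?) x) (cong does eq))
... | no ¬p = ⊥-elim (¬p p)

∈-tabulate⁻ : ∀ {n} {P : Fin n → Set} (P? : Decidable P) {x} → x ∈ˢ Vec.tabulate (does ∘ P?) → P x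
∈-tabulate⁻ P? {x} x∈ with P? x in eq
... | yes p = p
... | no _ with trans (sym (Vec.[]=⇒lookup x∈)) (trans (Vec.lookup∘tabulate (does ∘ P?) x) (cong does eq))
... | ()

Unique-map⇒injective : {φ : X → Y} {xs : List X} → Unique (map φ xs) →
                       ∀ {x x′} → x ∈ xs → x′ ∈ xs → φ x ≡ φ x′ → x ≡ x′
Unique-map⇒injective (_ ∷ _) (here refl) (here refl) _ = refl
Unique-map⇒injective {φ = φ} (x∉ ∷ _) (here refl) (there q) e = ⊥-elim (All.lookup x∉ (∈-map⁺ φ q) e)
Unique-map⇒injective {φ = φ} (x∉ ∷ _) (there p) (here refl) e = ⊥-elim (All.lookup x∉ (∈-map⁺ φ p) (sym e))
Unique-map⇒injective (_ ∷ u) (there p) (there q) e = Unique-map⇒injective u p q e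

-- Arithmetic in a finite field

module FieldLemmas {q : ℕ} (F : FiniteField q) where
  open FiniteField F renaming (_+_ to infixl 6 _⊕_; _*_ to infixl 7 _⊗_; -_ to infix 8 ⊖_; _⁻¹ to infix 8 _⁻¹)

  ring : CommutativeRing _ _
  ring = record { isCommutativeRing = isCommutativeRing }

  open CommutativeRing ring using (commutativeSemiring) public
    renaming (+-identityʳ to ⊕-identityʳ; +-identityˡ to ⊕-identityˡ; *-identityʳ to ⊗-identityʳ; zeroˡ to ⊗-zeroˡ; *-comm to ⊗-comm; *-assoc to ⊗-assoc;
              *-identityˡ to ⊗-identityˡ; +-comm to ⊕-comm; +-assoc to ⊕-assoc; -‿inverseʳ to ⊖-inverseʳ; -‿inverseˡ to ⊖-inverseˡ;
              distribˡ to ⊗-distribˡ-⊕; distribʳ to ⊗-distribʳ-⊕)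
  open RingProperties (CommutativeRing.ring ring) using (-1*x≈-x; -‿involutive; -‿+-comm; -‿distribˡ-*) public
  open GroupProperties (CommutativeRing.+-group ring) public using () renaming (∙-cancelʳ to ⊕-cancelʳ; ∙-cancelˡ to ⊕-cancelˡ)
  module S = SemiringSolver commutativeSemiring

  _≟_ : DecidableEquality (Fin q)
  _≟_ = Fin._≟_

  open DecMembership _≟_ using (_∈?_) public

  ⁻¹-cancelˡ : ∀ {u} x → u ≢ 0# → u ⁻¹ ⊗ (u ⊗ x) ≡ x
  ⁻¹-cancelˡ {u} x u≢0 = begin
    u ⁻¹ ⊗ (u ⊗ x) ≡⟨ S.solve 3 (λ i u x → i S.:* (u S.:* x) S.:= (u S.:* i) S.:* x) refl (u ⁻¹) u x ⟩
    u ⊗ u ⁻¹ ⊗ x   ≡⟨ cong (_⊗ x) (inverseʳ u u≢0) ⟩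
    1# ⊗ x         ≡⟨ ⊗-identityˡ x ⟩
    x              ∎
    where open ≡-Reasoning

  ⁻¹-cancelʳ : ∀ {u} x → u ≢ 0# → u ⊗ (u ⁻¹ ⊗ x) ≡ x
  ⁻¹-cancelʳ {u} x u≢0 = trans
    (S.solve 3 (λ i u x → u S.:* (i S.:* x) S.:= i S.:* (u S.:* x)) refl (u ⁻¹) u x) (⁻¹-cancelˡ x u≢0)

  ⊗-cancelˡ : ∀ {u x y} → u ≢ 0# → u ⊗ x ≡ u ⊗ y → x ≡ y
  ⊗-cancelˡ {u} {x} {y} u≢0 e = trans (sym (⁻¹-cancelˡ x u≢0)) (trans (cong (u ⁻¹ ⊗_) e) (⁻¹-cancelˡ y u≢0))

  private
    -- Minus one as a variable of the semiring solver, with the negative of `x` entered as `𝔪 ⊗ x`.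
    𝔪 = ⊖ 1#
    𝔪-cancel : ∀ x → x ⊕ 𝔪 ⊗ x ≡ 0#
    𝔪-cancel x = trans (cong (x ⊕_) (-1*x≈-x x)) (⊖-inverseʳ x)

  ⊖-cancel : ∀ {c d} → c ⊕ ⊖ d ≡ 0# → c ≡ d
  ⊖-cancel {c} {d} e = ⊕-cancelʳ (⊖ d) c d (trans e (sym (⊖-inverseʳ d)))

  difference-cancel : ∀ {c d v v′} → c ≢ d → c ⊗ v ⊕ ⊖ (d ⊗ v) ≡ c ⊗ v′ ⊕ ⊖ (d ⊗ v′) → v ≡ v′
  difference-cancel {c} {d} {v} {v′} c≢d e =
    ⊗-cancelˡ (c≢d ∘ ⊖-cancel) (trans (factor v) (trans e (sym (factor v′))))
    where
    factor : ∀ v → (c ⊕ ⊖ d) ⊗ v ≡ c ⊗ v ⊕ ⊖ (d ⊗ v)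
    factor v = trans (cong (λ z → (c ⊕ z) ⊗ v) (sym (-1*x≈-x d))) (trans
      (S.solve 4 (λ c d v m → (c S.:+ m S.:* d) S.:* v S.:= c S.:* v S.:+ m S.:* (d S.:* v)) refl c d v 𝔪)
      (cong (c ⊗ v ⊕_) (-1*x≈-x (d ⊗ v))))

  -- With ρ = (a − b) / (c − d), this is (c − d) h + (a − b) y = (c − d) (h + ρ y).
  linear-form : ∀ {ρ a b c d} → ρ ⊗ c ⊕ b ≡ ρ ⊗ d ⊕ a → ∀ h y →
                c ⊗ h ⊕ ⊖ (d ⊗ h) ⊕ a ⊗ y ⊕ ⊖ (b ⊗ y) ≡ c ⊗ (h ⊕ ρ ⊗ y) ⊕ ⊖ (d ⊗ (h ⊕ ρ ⊗ y))
  linear-form {ρ} {a} {b} {c} {d} e h y = begin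
    c ⊗ h ⊕ ⊖ (d ⊗ h) ⊕ a ⊗ y ⊕ ⊖ (b ⊗ y)
      ≡⟨ cong₂ (λ u v → c ⊗ h ⊕ u ⊕ a ⊗ y ⊕ v) (-1*x≈-x (d ⊗ h)) (-1*x≈-x (b ⊗ y)) ⟨
    c ⊗ h ⊕ 𝔪 ⊗ (d ⊗ h) ⊕ a ⊗ y ⊕ 𝔪 ⊗ (b ⊗ y)
      ≡⟨ ⊕-identityʳ _ ⟨
    c ⊗ h ⊕ 𝔪 ⊗ (d ⊗ h) ⊕ a ⊗ y ⊕ 𝔪 ⊗ (b ⊗ y) ⊕ 0#
      -- Inserting `ρdy - ρdy` produces the factor `ρ ⊗ d ⊕ a`, to which the slope equation `e`
      -- applies.
      ≡⟨ cong (c ⊗ h ⊕ 𝔪 ⊗ (d ⊗ h) ⊕ a ⊗ y ⊕ 𝔪 ⊗ (b ⊗ y) ⊕_) (𝔪-cancel (ρ ⊗ d ⊗ y)) ⟨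
    c ⊗ h ⊕ 𝔪 ⊗ (d ⊗ h) ⊕ a ⊗ y ⊕ 𝔪 ⊗ (b ⊗ y) ⊕ (ρ ⊗ d ⊗ y ⊕ 𝔪 ⊗ (ρ ⊗ d ⊗ y))
      ≡⟨ S.solve 8 (λ ρ a b c d h y m → c S.:* h S.:+ m S.:* (d S.:* h) S.:+ a S.:* y S.:+ m S.:* (b S.:* y) S.:+ (ρ S.:* d S.:* y S.:+ m S.:* (ρ S.:* d S.:* y))
           S.:= c S.:* h S.:+ m S.:* (d S.:* h) S.:+ (ρ S.:* d S.:+ a) S.:* y S.:+ m S.:* (b S.:* y) S.:+ m S.:* (ρ S.:* d S.:* y)) refl ρ a b c d h y 𝔪 ⟩
    c ⊗ h ⊕ 𝔪 ⊗ (d ⊗ h) ⊕ (ρ ⊗ d ⊕ a) ⊗ y ⊕ 𝔪 ⊗ (b ⊗ y) ⊕ 𝔪 ⊗ (ρ ⊗ d ⊗ y)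
      ≡⟨ cong (λ k → c ⊗ h ⊕ 𝔪 ⊗ (d ⊗ h) ⊕ k ⊗ y ⊕ 𝔪 ⊗ (b ⊗ y) ⊕ 𝔪 ⊗ (ρ ⊗ d ⊗ y)) e ⟨
    c ⊗ h ⊕ 𝔪 ⊗ (d ⊗ h) ⊕ (ρ ⊗ c ⊕ b) ⊗ y ⊕ 𝔪 ⊗ (b ⊗ y) ⊕ 𝔪 ⊗ (ρ ⊗ d ⊗ y)
      ≡⟨ S.solve 7 (λ ρ b c d h y m → c S.:* h S.:+ m S.:* (d S.:* h) S.:+ (ρ S.:* c S.:+ b) S.:* y S.:+ m S.:* (b S.:* y) S.:+ m S.:* (ρ S.:* d S.:* y)
           S.:= c S.:* (h S.:+ ρ S.:* y) S.:+ m S.:* (d S.:* (h S.:+ ρ S.:* y)) S.:+ (b S.:* y S.:+ m S.:* (b S.:* y))) refl ρ b c d h y 𝔪 ⟩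
    c ⊗ (h ⊕ ρ ⊗ y) ⊕ 𝔪 ⊗ (d ⊗ (h ⊕ ρ ⊗ y)) ⊕ (b ⊗ y ⊕ 𝔪 ⊗ (b ⊗ y))
      ≡⟨ cong₂ (λ u v → c ⊗ (h ⊕ ρ ⊗ y) ⊕ u ⊕ v) (-1*x≈-x (d ⊗ (h ⊕ ρ ⊗ y))) (𝔪-cancel (b ⊗ y)) ⟩
    c ⊗ (h ⊕ ρ ⊗ y) ⊕ ⊖ (d ⊗ (h ⊕ ρ ⊗ y)) ⊕ 0#
      ≡⟨ ⊕-identityʳ _ ⟩
    c ⊗ (h ⊕ ρ ⊗ y) ⊕ ⊖ (d ⊗ (h ⊕ ρ ⊗ y)) ∎
    where open ≡-Reasoning

  -- The left side of `linear-form` does not mention the slope; at `h = 0`, `y = 1` the right side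
  -- is `c - d` times the slope.
  slope-unique : ∀ {ρ σ a b c d} → c ≢ d → ρ ⊗ c ⊕ b ≡ ρ ⊗ d ⊕ a → σ ⊗ c ⊕ b ≡ σ ⊗ d ⊕ a → ρ ≡ σ
  slope-unique {ρ} {σ} c≢d e e′ = ⊗-cancelˡ′ (⊕-cancelˡ 0# _ _
    (difference-cancel c≢d (trans (sym (linear-form e 0# 1#)) (linear-form e′ 0# 1#))))
    where
    ⊗-cancelˡ′ : ρ ⊗ 1# ≡ σ ⊗ 1# → ρ ≡ σ
    ⊗-cancelˡ′ e = trans (sym (⊗-identityʳ ρ)) (trans e (⊗-identityʳ σ))

  -- An injective self-map of a finite set is onto. If `u ⁻¹ ⊗ x` failed `P`, then adjoining it to
  -- the set of solutions of `P` would give a larger set that `u ⊗_` maps injectively into the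
  -- solutions.
  stable-⁻¹ : {P : Fin q → Set} (P? : Decidable P) {u : Fin q} → u ≢ 0# →
              (∀ {x} → P x → P (u ⊗ x)) → ∀ {x} → P x → P (u ⁻¹ ⊗ x)
  stable-⁻¹ {P} P? {u} u≢0 stable {x} px with P? (u ⁻¹ ⊗ x)
  ... | yes p = p
  ... | no ¬p = ⊥-elim (<-irrefl refl (injection⇒length-≤ _≟_
    (All.tabulate (λ { y∈ refl → ¬p (proj₂ (∈-filter⁻ P? {xs = allFin q} y∈)) }) ∷ Unique.filter⁺ P? (Unique.allFin⁺ q))
    (filter P? (allFin q)) (u ⊗_) (λ _ _ → ⊗-cancelˡ u≢0) into))
    where
    into : ∀ {y} → y ∈ u ⁻¹ ⊗ x ∷ filter P? (allFin q) → u ⊗ y ∈ filter P? (allFin q)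
    into (here refl) = ∈-filter⁺ P? (∈-allFin _) (subst P (sym (⁻¹-cancelʳ x u≢0)) px)
    into (there y∈)  = ∈-filter⁺ P? (∈-allFin _) (stable (proj₂ (∈-filter⁻ P? {xs = allFin q} y∈)))

  -- Popular translates

  -- All sums `h s ⊕ v` lie in one translate of `Z`, which forces energy at least
  -- `(|S| |V|)² / |Z|`. Hence a single translate of `V`, or of its negative, captures `h s` for a
  -- proportion `|V| / |Z|` of `S`. The shift `w` pads the sum to four terms.
  module _ (S : List X) (h : X → Fin q) {V Z : List (Fin q)} (V-unique : Unique V) (w : Fin q)
           (into : ∀ {s v} → s ∈ S → v ∈ V → h s ⊕ v ⊕ w ∈ Z) where

    private
      g : X × Fin q → Fin q
      g (s , v) = h s ⊕ v ⊕ w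

      energy = collisions _≟_ g (cartesianProduct S V)

      energy-≥ : (length S * length V) * (length S * length V) ≤ length Z * energy
      energy-≥ = subst (λ k → k * k ≤ length Z * energy) (length-cartesianProduct S V)
        (length²≤collisions _≟_ g (cartesianProduct S V) Z
          λ p∈ → let s∈ , v∈ = ∈-cartesianProduct⁻ S V p∈ in into s∈ v∈)

      -- By `energy-≥` the mean of `T` over `S × V` is at least `|S| |V| / |Z|`, so some value is;
      -- the first alternative is an empty product, which has no maximum.
      fromAverage : (T : X × Fin q → ℕ) → energy ≤ ∑ (cartesianProduct S V) T →
                    (length S * length V ≡ 0) ⊎ ∃ λ p → length S * length V ≤ length Z * T p
      fromAverage T le with ∑-≤-argmax (cartesianProduct S V) T
      ... | inj₁ e = inj₁ (trans (sym (length-cartesianProduct S V)) e)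
      ... | inj₂ (p , _ , le′) = inj₂ (p , m*m≤m*k⇒m≤k (begin
        m * m                       ≤⟨ energy-≥ ⟩
        length Z * energy           ≤⟨ *-monoʳ-≤ (length Z) (≤-trans le le′) ⟩
        length Z * (length (cartesianProduct S V) * T p)
                                    ≡⟨ cong (λ k → length Z * (k * T p)) (length-cartesianProduct S V) ⟩
        length Z * (m * T p)        ≡⟨ solve 3 (λ z l t → z :* (l :* t) := l :* (z :* t)) refl (length Z) m (T p) ⟩
        m * (length Z * T p)        ∎))
        where
        open ≤-Reasoning
        open +-*-Solver
        m = length S * length V

    sum-fibre? : (t : Fin q) → Decidable (λ s → ∃ λ v → v ∈ V × h s ⊕ v ≡ t)
    sum-fibre? t s = Fin.any? λ v → (v ∈? V) ×-dec ((h s ⊕ v) ≟ t)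

    difference-fibre? : (t : Fin q) → Decidable (λ s → ∃ λ v → v ∈ V × h s ≡ t ⊕ v)
    difference-fibre? t s = Fin.any? λ v → (v ∈? V) ×-dec (h s ≟ (t ⊕ v))

    -- For fixed `(s , v)` and `s′` at most one `v′` gives the same sum, so the energy is at most
    -- the total of the fibre sizes at `t = h s ⊕ v`.
    popular-sum : ∃ λ t → length S * length V ≤ length Z * length (filter (sum-fibre? t) S)
    popular-sum with fromAverage (λ p → ∑ S (𝟙 ∘ sum-fibre? (h (proj₁ p) ⊕ proj₂ p)))
      (∑-mono (cartesianProduct S V) λ { {s , v} _ → ≤-trans
        (≤-reflexive (∑-cartesianProduct S V _)) (∑-mono S λ {s′} _ →
          ∑-unique-≤ (λ v′ → g (s , v) ≟ g (s′ , v′)) (sum-fibre? (h s ⊕ v) s′) V-unique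
            (λ _ _ e e′ → ⊕-cancelˡ (h s′) _ _ (⊕-cancelʳ w _ _ (trans (sym e) e′)))
            (λ v′∈ e → _ , v′∈ , sym (⊕-cancelʳ w _ _ e))) })
    ... | inj₁ e = 0# , ≤-trans (≤-reflexive e) z≤n
    ... | inj₂ ((s , v) , le) = h s ⊕ v , ≤-trans le (≤-reflexive (cong (length Z *_) (sym (length-filter≡∑ _ S))))

    -- h s + v = h s′ + v′ is also h s − v′ = h s′ − v, so the energy bounds differences as well.
    popular-difference : ∃ λ t → length S * length V ≤ length Z * length (filter (difference-fibre? t) S)
    popular-difference with fromAverage (λ p → ∑ S (𝟙 ∘ difference-fibre? (h (proj₁ p) ⊕ ⊖ proj₂ p))) (begin
      energy
        ≡⟨ trans (∑-cartesianProduct S V _) (∑-cong S λ s → ∑-cong V λ v → ∑-cartesianProduct S V _) ⟩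
      ∑ S (λ s → ∑ V λ v → ∑ S λ s′ → ∑ V λ v′ → 𝟙 (g (s , v) ≟ g (s′ , v′)))
        -- The order of summation is changed to put `(s , v′)`, which determines the difference,
        -- outermost and `v` innermost.
        ≡⟨ ∑-cong S (λ s → trans (∑-cong V λ v → ∑-swap S V _) (∑-swap V V _)) ⟩
      ∑ S (λ s → ∑ V λ v′ → ∑ V λ v → ∑ S λ s′ → 𝟙 (g (s , v) ≟ g (s′ , v′)))
        ≡⟨ ∑-cong S (λ s → ∑-cong V λ v′ → ∑-swap V S _) ⟩
      ∑ S (λ s → ∑ V λ v′ → ∑ S λ s′ → ∑ V λ v → 𝟙 (g (s , v) ≟ g (s′ , v′)))
        ≤⟨ ∑-mono S (λ {s} _ → ∑-mono V λ {v′} _ → ∑-mono S λ {s′} _ →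
             ∑-unique-≤ (λ v → g (s , v) ≟ g (s′ , v′)) (difference-fibre? (h s ⊕ ⊖ v′) s′) V-unique
               (λ _ _ e e′ → ⊕-cancelˡ (h s) _ _ (⊕-cancelʳ w _ _ (trans e (sym e′))))
               (λ {v} v∈ e → v , v∈ , exchange s v s′ v′ (⊕-cancelʳ w _ _ e))) ⟩
      ∑ S (λ s → ∑ V λ v′ → ∑ S (𝟙 ∘ difference-fibre? (h s ⊕ ⊖ v′)))
        ≡⟨ ∑-cartesianProduct S V _ ⟨
      ∑ (cartesianProduct S V) (λ p → ∑ S (𝟙 ∘ difference-fibre? (h (proj₁ p) ⊕ ⊖ proj₂ p))) ∎)
      where
      open ≤-Reasoning
      exchange : ∀ s v s′ v′ → h s ⊕ v ≡ h s′ ⊕ v′ → h s′ ≡ h s ⊕ ⊖ v′ ⊕ v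
      exchange s v s′ v′ e = ⊕-cancelʳ v′ _ _ (trans (sym e) (sym (trans
        (S.solve 4 (λ a n v v′ → a S.:+ n S.:+ v S.:+ v′ S.:= a S.:+ v S.:+ (v′ S.:+ n)) refl (h s) (⊖ v′) v v′)
        (trans (cong (h s ⊕ v ⊕_) (⊖-inverseʳ v′)) (⊕-identityʳ _)))))
    ... | inj₁ e = 0# , ≤-trans (≤-reflexive e) z≤n
    ... | inj₂ ((s , v) , le) = h s ⊕ ⊖ v , ≤-trans le (≤-reflexive (cong (length Z *_) (sym (length-filter≡∑ _ S))))

-- With `d = Q / P` and denominators cleared: `d⁴ l² ≤ 2 z⁵` or `d⁵ ≤ z⁴`.
Dichotomy : (P Q l z : ℕ) → Set
Dichotomy P Q l z =
  Q * Q * Q * Q * (l * l) ≤ 2 * (P * z * (P * z) * (P * z) * (P * z) * z) ⊎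
  Q * Q * Q * (Q * Q) ≤ P * P * (P * z * (P * z) * (P * z)) * z

-- Restriction of pairs to translates of `A`

module SumRatio {q : ℕ} (F : FiniteField q) where
  open FiniteField F renaming (_+_ to infixl 6 _⊕_; _*_ to infixl 7 _⊗_; -_ to infix 8 ⊖_; _⁻¹ to infix 8 _⁻¹)
  open FieldLemmas F

  module Bound (A B Z : List (Fin q)) (P Q : ℕ)
    (sums : ∀ {a b c d} → a ∈ A → b ∈ A → c ∈ A → d ∈ A → a ⊕ b ⊕ c ⊕ d ∈ Z)
    (B-unique : Unique B) (B⊆A : ∀ {b} → b ∈ B → b ∈ A) (0∉B : ¬ 0# ∈ B)
    (popular : ∀ {b} → b ∈ B → Q ≤ P * length (filter (λ x → b ⊗ x ∈? A) B))
    {b₀ b₁ : Fin q} (b₀∈B : b₀ ∈ B) (b₁∈B : b₁ ∈ B) (b₀≢b₁ : b₀ ≢ b₁)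
    where

    record Refinement (g : X → Fin q) (m k : ℕ) (S : List X) : Set where
      field
        part        : List X
        part⊆       : ∀ {s} → s ∈ part → s ∈ S
        part-unique : Unique part
        large       : m * length S ≤ k * length part
        offset      : Fin q
        into        : ∀ {s} → s ∈ part → ∃ λ a → a ∈ A × g s ≡ offset ⊕ a

    -- Quantifying over all duplicate-free lists from `S` allows several functions to be refined in
    -- succession, each on what the previous one left.
    Refinable : (X → Fin q) → ℕ → ℕ → List X → Set
    Refinable g m k S = ∀ T → (∀ {s} → s ∈ T → s ∈ S) → Unique T → Refinement g m k T

    -- After all four refinements the sum of the `g` values lies in one translate of `Z` and is
    -- still injective, so at most `|Z|` elements remain.
    four-terms : {S : List X} → Unique S → (g₁ g₂ g₃ g₄ : X → Fin q) →
      (∀ {s s′} → s ∈ S → s′ ∈ S → g₁ s ⊕ g₂ s ⊕ g₃ s ⊕ g₄ s ≡ g₁ s′ ⊕ g₂ s′ ⊕ g₃ s′ ⊕ g₄ s′ → s ≡ s′) →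
      ∀ {m₁ m₂ m₃ m₄ k₁ k₂ k₃ k₄} →
      Refinable g₁ m₁ k₁ S → Refinable g₂ m₂ k₂ S → Refinable g₃ m₃ k₃ S → Refinable g₄ m₄ k₄ S →
      m₁ * m₂ * m₃ * m₄ * length S ≤ k₁ * k₂ * k₃ * k₄ * length Z
    four-terms {S = S} u g₁ g₂ g₃ g₄ inj {m₁} {m₂} {m₃} {m₄} {k₁} {k₂} {k₃} {k₄} ref₁ ref₂ ref₃ ref₄ = begin
      m₁ * m₂ * m₃ * m₄ * length S          ≡⟨ solve 5 (λ a b c d s → a :* b :* c :* d :* s := b :* c :* d :* (a :* s)) refl m₁ m₂ m₃ m₄ (length S) ⟩
      m₂ * m₃ * m₄ * (m₁ * length S)        ≤⟨ *-monoʳ-≤ (m₂ * m₃ * m₄) R₁.large ⟩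
      m₂ * m₃ * m₄ * (k₁ * length R₁.part)  ≡⟨ solve 5 (λ a b c d s → b :* c :* d :* (a :* s) := a :* c :* d :* (b :* s)) refl k₁ m₂ m₃ m₄ (length R₁.part) ⟩
      k₁ * m₃ * m₄ * (m₂ * length R₁.part)  ≤⟨ *-monoʳ-≤ (k₁ * m₃ * m₄) R₂.large ⟩
      k₁ * m₃ * m₄ * (k₂ * length R₂.part)  ≡⟨ solve 5 (λ a b c d s → a :* c :* d :* (b :* s) := a :* b :* d :* (c :* s)) refl k₁ k₂ m₃ m₄ (length R₂.part) ⟩
      k₁ * k₂ * m₄ * (m₃ * length R₂.part)  ≤⟨ *-monoʳ-≤ (k₁ * k₂ * m₄) R₃.large ⟩
      k₁ * k₂ * m₄ * (k₃ * length R₃.part)  ≡⟨ solve 5 (λ a b c d s → a :* b :* d :* (c :* s) := a :* b :* c :* (d :* s)) refl k₁ k₂ k₃ m₄ (length R₃.part) ⟩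
      k₁ * k₂ * k₃ * (m₄ * length R₃.part)  ≤⟨ *-monoʳ-≤ (k₁ * k₂ * k₃) R₄.large ⟩
      k₁ * k₂ * k₃ * (k₄ * length R₄.part)  ≡⟨ *-assoc (k₁ * k₂ * k₃) k₄ _ ⟨
      k₁ * k₂ * k₃ * k₄ * length R₄.part    ≤⟨ *-monoʳ-≤ (k₁ * k₂ * k₃ * k₄) final ⟩
      k₁ * k₂ * k₃ * k₄ * length Z          ∎
      where
      open ≤-Reasoning
      open +-*-Solver
      module R₁ = Refinement (ref₁ S id u)
      module R₂ = Refinement (ref₂ R₁.part R₁.part⊆ R₁.part-unique)
      module R₃ = Refinement (ref₃ R₂.part (R₁.part⊆ ∘ R₂.part⊆) R₂.part-unique)
      module R₄ = Refinement (ref₄ R₃.part (R₁.part⊆ ∘ R₂.part⊆ ∘ R₃.part⊆) R₃.part-unique)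
      S₄⊆S : ∀ {s} → s ∈ R₄.part → s ∈ S
      S₄⊆S = R₁.part⊆ ∘ R₂.part⊆ ∘ R₃.part⊆ ∘ R₄.part⊆
      t = R₁.offset ⊕ R₂.offset ⊕ R₃.offset ⊕ R₄.offset
      lands : ∀ {s} → s ∈ R₄.part → g₁ s ⊕ g₂ s ⊕ g₃ s ⊕ g₄ s ∈ map (t ⊕_) Z
      lands s∈ with R₁.into (R₂.part⊆ (R₃.part⊆ (R₄.part⊆ s∈))) | R₂.into (R₃.part⊆ (R₄.part⊆ s∈))
                  | R₃.into (R₄.part⊆ s∈) | R₄.into s∈
      ... | a , a∈ , ea | b , b∈ , eb | c , c∈ , ec | d , d∈ , ed rewrite ea | eb | ec | ed =
        subst (_∈ map (t ⊕_) Z)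
          (S.solve 8 (λ p q r s a b c d → p S.:+ q S.:+ r S.:+ s S.:+ (a S.:+ b S.:+ c S.:+ d)
             S.:= p S.:+ a S.:+ (q S.:+ b) S.:+ (r S.:+ c) S.:+ (s S.:+ d)) refl
             R₁.offset R₂.offset R₃.offset R₄.offset a b c d)
          (∈-map⁺ (t ⊕_) (sums a∈ b∈ c∈ d∈))
      final : length R₄.part ≤ length Z
      final = ≤-trans (injection⇒length-≤ _≟_ R₄.part-unique (map (t ⊕_) Z) _
        (λ p q → inj (S₄⊆S p) (S₄⊆S q)) lands) (≤-reflexive (length-map (t ⊕_) Z))

    trivial : {S : List X} {g : X → Fin q} → (∀ {s} → s ∈ S → g s ∈ A) → Refinable g 1 1 S
    trivial g∈A T T⊆S u = record
      { part = T ; part⊆ = id ; part-unique = u ; large = ≤-refl ; offset = 0#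
      ; into = λ s∈ → _ , g∈A (T⊆S s∈) , sym (⊕-identityˡ _) }

    -- A refinement keeps the proportion `Q / κ`, that is `(Q / P) / |Z|`.
    κ = P * length Z

    module _ {S : List X} (h : X → Fin q) (w : Fin q)
             (into-Z : ∀ {s v} → s ∈ S → v ∈ B → h s ⊕ v ⊕ w ∈ Z) {c : Fin q} (c∈B : c ∈ B) where

      private
        V : List (Fin q)
        V = filter (λ x → c ⊗ x ∈? A) B

        V-unique : Unique V
        V-unique = Unique.filter⁺ (λ x → c ⊗ x ∈? A) B-unique

        V⊆B : ∀ {v} → v ∈ V → v ∈ B
        V⊆B = proj₁ ∘ ∈-filter⁻ (λ x → c ⊗ x ∈? A) {xs = B}

        cV⊆A : ∀ {v} → v ∈ V → c ⊗ v ∈ A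
        cV⊆A = proj₂ ∘ ∈-filter⁻ (λ x → c ⊗ x ∈? A) {xs = B}

        large-part : ∀ {l k} → l * length V ≤ length Z * k → Q * l ≤ κ * k
        large-part {l} {k} le = begin
          Q * l                  ≤⟨ *-monoˡ-≤ l (popular c∈B) ⟩
          P * length V * l       ≡⟨ solve 3 (λ p v l → p :* v :* l := p :* (l :* v)) refl P (length V) l ⟩
          P * (l * length V)     ≤⟨ *-monoʳ-≤ P le ⟩
          P * (length Z * k)     ≡⟨ *-assoc P (length Z) k ⟨
          κ * k                  ∎
          where
          open ≤-Reasoning
          open +-*-Solver

      -- On the popular fibre `h s = t + v` with `v ∈ V`, so `c h s = c t + c v` and `c v ∈ A`.
      refine⁺ : Refinable (λ s → c ⊗ h s) Q κ S
      refine⁺ T T⊆S u with popular-difference T h V-unique w (λ s∈ v∈ → into-Z (T⊆S s∈) (V⊆B v∈))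
      ... | t , le = record
        { part = filter fibre? T
        ; part⊆ = proj₁ ∘ ∈-filter⁻ fibre? {xs = T}
        ; part-unique = Unique.filter⁺ fibre? u
        ; large = large-part le
        ; offset = c ⊗ t
        ; into = λ s∈ → let v , v∈ , e = proj₂ (∈-filter⁻ fibre? {xs = T} s∈) in
            c ⊗ v , cV⊆A v∈ , trans (cong (c ⊗_) e) (⊗-distribˡ-⊕ c t v) }
        where fibre? = difference-fibre? T h V-unique w (λ s∈ v∈ → into-Z (T⊆S s∈) (V⊆B v∈)) t

      -- Here the fibre is `h s + v = t`: the minus sign turns `v` back into a positive term,
      -- `- c h s = - c t + c v`.
      refine⁻ : Refinable (λ s → ⊖ (c ⊗ h s)) Q κ S
      refine⁻ T T⊆S u with popular-sum T h V-unique w (λ s∈ v∈ → into-Z (T⊆S s∈) (V⊆B v∈))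
      ... | t , le = record
        { part = filter fibre? T
        ; part⊆ = proj₁ ∘ ∈-filter⁻ fibre? {xs = T}
        ; part-unique = Unique.filter⁺ fibre? u
        ; large = large-part le
        ; offset = ⊖ (c ⊗ t)
        ; into = λ s∈ → let v , v∈ , e = proj₂ (∈-filter⁻ fibre? {xs = T} s∈) in
            c ⊗ v , cV⊆A v∈ , negate (h _) v e }
        where
        fibre? = sum-fibre? T h V-unique w (λ s∈ v∈ → into-Z (T⊆S s∈) (V⊆B v∈)) t
        negate : ∀ x v → x ⊕ v ≡ t → ⊖ (c ⊗ x) ≡ ⊖ (c ⊗ t) ⊕ c ⊗ v
        negate x v refl = ⊕-cancelʳ (c ⊗ x) _ _ (begin
          ⊖ (c ⊗ x) ⊕ c ⊗ x                     ≡⟨ ⊖-inverseˡ (c ⊗ x) ⟩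
          0#                                    ≡⟨ ⊖-inverseˡ (c ⊗ (x ⊕ v)) ⟨
          ⊖ (c ⊗ (x ⊕ v)) ⊕ c ⊗ (x ⊕ v)         ≡⟨ S.solve 4 (λ n c x v → n S.:+ c S.:* (x S.:+ v) S.:= n S.:+ c S.:* v S.:+ c S.:* x) refl (⊖ (c ⊗ (x ⊕ v))) c x v ⟩
          ⊖ (c ⊗ (x ⊕ v)) ⊕ c ⊗ v ⊕ c ⊗ x       ∎)
          where open ≡-Reasoning

    two-summands : ∀ {a v} → a ∈ A → v ∈ B → a ⊕ v ⊕ (b₀ ⊕ b₀) ∈ Z
    two-summands {a} {v} a∈ v∈ = subst (_∈ Z) (⊕-assoc (a ⊕ v) b₀ b₀) (sums a∈ (B⊆A v∈) (B⊆A b₀∈B) (B⊆A b₀∈B))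

    -- Slopes and the bounds when their set is not closed

    Slope : Fin q → Set
    Slope ρ = ∃ λ a → ∃ λ b → ∃ λ c → ∃ λ d →
      -- The equation is `ρ = (a - b) / (c - d)` freed of division and subtraction.
      a ∈ B × b ∈ B × c ∈ B × d ∈ B × c ≢ d × ρ ⊗ c ⊕ b ≡ ρ ⊗ d ⊕ a

    Slope? : Decidable Slope
    Slope? ρ = Fin.any? λ a → Fin.any? λ b → Fin.any? λ c → Fin.any? λ d →
      (a ∈? B) ×-dec (b ∈? B) ×-dec (c ∈? B) ×-dec (d ∈? B) ×-dec ¬? (c ≟ d) ×-dec ((ρ ⊗ c ⊕ b) ≟ (ρ ⊗ d ⊕ a))

    ¬Slope⇒injective : ∀ {ρ} → ¬ Slope ρ → ∀ {x y x′ y′} → x ∈ B → y ∈ B → x′ ∈ B → y′ ∈ B →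
                       x ⊕ ρ ⊗ y ≡ x′ ⊕ ρ ⊗ y′ → (x , y) ≡ (x′ , y′)
    ¬Slope⇒injective {ρ} ¬slope {x} {y} {x′} {y′} x∈ y∈ x′∈ y′∈ e with y ≟ y′
    ... | yes refl = cong (_, y) (⊕-cancelʳ (ρ ⊗ y) x x′ e)
    ... | no y≢y′ = ⊥-elim (¬slope (x′ , x , y , y′ , x′∈ , x∈ , y∈ , y′∈ , y≢y′ ,
      trans (⊕-comm (ρ ⊗ y) x) (trans e (⊕-comm x′ (ρ ⊗ y′)))))

    -- Multiplying `h + ρ k` by `c - d` gives `c h - d h + a k - b k`, still injective on `S`, and
    -- each of the four terms can be refined.
    slope-bound : {ρ : Fin q} → Slope ρ → {S : List X} → Unique S → (h k : X → Fin q) (w : Fin q) →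
      (∀ {s v} → s ∈ S → v ∈ B → h s ⊕ v ⊕ w ∈ Z) → (∀ {s} → s ∈ S → k s ∈ A) →
      (∀ {s s′} → s ∈ S → s′ ∈ S → h s ⊕ ρ ⊗ k s ≡ h s′ ⊕ ρ ⊗ k s′ → s ≡ s′) →
      Q * Q * Q * Q * length S ≤ κ * κ * κ * κ * length Z
    slope-bound (a , b , c , d , a∈ , b∈ , c∈ , d∈ , c≢d , e) u h k w h-into k-into inj =
      four-terms u (λ s → c ⊗ h s) (λ s → ⊖ (d ⊗ h s)) (λ s → a ⊗ k s) (λ s → ⊖ (b ⊗ k s))
        (λ {s} {s′} s∈ s′∈ eq → inj s∈ s′∈ (difference-cancel c≢d
          (trans (sym (linear-form e (h s) (k s))) (trans eq (linear-form e (h s′) (k s′))))))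
        (refine⁺ h w h-into c∈) (refine⁻ h w h-into d∈)
        (refine⁺ k _ (two-summands ∘ k-into) a∈) (refine⁻ k _ (two-summands ∘ k-into) b∈)

    B² = cartesianProduct B B

    B²-unique : Unique B²
    B²-unique = Unique.cartesianProduct⁺ B-unique B-unique

    -- Since `x + (1 + ρ) y = (x + y) + ρ y`, `slope-bound` applies with `h = x + y` and `k = y`;
    -- `x + y + v + b₀` is a fourfold sum.
    successor-escapes : ∀ {ρ} → Slope ρ → ¬ Slope (1# ⊕ ρ) →
      Q * Q * Q * Q * (length B * length B) ≤ κ * κ * κ * κ * length Z
    successor-escapes {ρ} slope ¬slope = subst (λ l → Q * Q * Q * Q * l ≤ κ * κ * κ * κ * length Z)
      (length-cartesianProduct B B)
      (slope-bound slope B²-unique (λ { (x , y) → x ⊕ y }) proj₂ b₀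
        (λ s∈ v∈ → let x∈ , y∈ = ∈-cartesianProduct⁻ B B s∈ in sums (B⊆A x∈) (B⊆A y∈) (B⊆A v∈) (B⊆A b₀∈B))
        (λ s∈ → B⊆A (proj₂ (∈-cartesianProduct⁻ B B s∈)))
        (λ { {x , y} {x′ , y′} s∈ s′∈ e →
          let x∈ , y∈ = ∈-cartesianProduct⁻ B B s∈
              x′∈ , y′∈ = ∈-cartesianProduct⁻ B B s′∈
          in ¬Slope⇒injective ¬slope x∈ y∈ x′∈ y′∈ (trans (regroup x y) (trans e (sym (regroup x′ y′)))) }))
      where
      regroup : ∀ x y → x ⊕ (1# ⊕ ρ) ⊗ y ≡ x ⊕ y ⊕ ρ ⊗ y
      regroup x y = S.solve 3 (λ x y ρ → x S.:+ (S.con 1 S.:+ ρ) S.:* y S.:= x S.:+ y S.:+ ρ S.:* y) refl x y ρ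

    -- Since `x + (β ρ) y = x + ρ (β y)`, take `h = x` and `k = β y`, on pairs with `c x ∈ A` and
    -- `β y ∈ A`. Popularity provides at least `(Q / P)²` such pairs.
    multiple-escapes : ∀ {β ρ} → β ∈ B → Slope ρ → ¬ Slope (β ⊗ ρ) →
      Q * Q * Q * (Q * Q) ≤ P * P * (κ * κ * κ) * length Z
    multiple-escapes {β} {ρ} β∈ (a , b , c , d , a∈ , b∈ , c∈ , d∈ , c≢d , e) ¬slope = begin
      Q * Q * Q * (Q * Q)                                       ≤⟨ *-monoʳ-≤ (Q * Q * Q) (*-mono-≤ (popular c∈) (popular β∈)) ⟩
      Q * Q * Q * (P * length (V c) * (P * length (V β)))       ≡⟨ solve 4 (λ q p v w → q :* q :* q :* (p :* v :* (p :* w)) := p :* p :* (con 1 :* q :* q :* q :* (v :* w))) refl Q P (length (V c)) (length (V β)) ⟩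
      P * P * (1 * Q * Q * Q * (length (V c) * length (V β)))   ≡⟨ cong (λ l → P * P * (1 * Q * Q * Q * l)) (length-cartesianProduct (V c) (V β)) ⟨
      P * P * (1 * Q * Q * Q * length S)                        ≤⟨ *-monoʳ-≤ (P * P) main ⟩
      P * P * (1 * κ * κ * κ * length Z)                        ≡⟨ solve 3 (λ p k z → p :* p :* (con 1 :* k :* k :* k :* z) := p :* p :* (k :* k :* k) :* z) refl P κ (length Z) ⟩
      P * P * (κ * κ * κ) * length Z                            ∎
      where
      open ≤-Reasoning
      open +-*-Solver
      V : Fin q → List (Fin q)
      V c = filter (λ x → c ⊗ x ∈? A) B
      ∈V : ∀ c {x} → x ∈ V c → x ∈ B × c ⊗ x ∈ A
      ∈V c = ∈-filter⁻ (λ x → c ⊗ x ∈? A) {xs = B}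
      S = cartesianProduct (V c) (V β)
      ∈S : ∀ {x y} → (x , y) ∈ S → (x ∈ B × c ⊗ x ∈ A) × (y ∈ B × β ⊗ y ∈ A)
      ∈S s∈ = let x∈ , y∈ = ∈-cartesianProduct⁻ (V c) (V β) s∈ in ∈V c x∈ , ∈V β y∈
      regroup : ∀ x y → x ⊕ (β ⊗ ρ) ⊗ y ≡ x ⊕ ρ ⊗ (β ⊗ y)
      regroup x y = S.solve 4 (λ β ρ x y → x S.:+ (β S.:* ρ) S.:* y S.:= x S.:+ ρ S.:* (β S.:* y)) refl β ρ x y
      k : Fin q × Fin q → Fin q
      k (x , y) = β ⊗ y
      main : 1 * Q * Q * Q * length S ≤ 1 * κ * κ * κ * length Z
      main = four-terms
        (Unique.cartesianProduct⁺ (Unique.filter⁺ (λ x → c ⊗ x ∈? A) B-unique) (Unique.filter⁺ (λ x → β ⊗ x ∈? A) B-unique))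
        (λ s → c ⊗ proj₁ s) (λ s → ⊖ (d ⊗ proj₁ s)) (λ s → a ⊗ k s) (λ s → ⊖ (b ⊗ k s))
        (λ { {x , y} {x′ , y′} s∈ s′∈ eq →
          ¬Slope⇒injective ¬slope (proj₁ (proj₁ (∈S s∈))) (proj₁ (proj₂ (∈S s∈))) (proj₁ (proj₁ (∈S s′∈))) (proj₁ (proj₂ (∈S s′∈)))
            (trans (regroup x y) (trans (difference-cancel c≢d
              (trans (sym (linear-form e x (β ⊗ y))) (trans eq (linear-form e x′ (β ⊗ y′))))) (sym (regroup x′ y′)))) })
        -- The term `c x` lies in `A` by the choice of pairs, so only three factors `Q / κ` are
        -- lost.
        (trivial (λ s∈ → proj₂ (proj₁ (∈S s∈))))
        (refine⁻ proj₁ _ (λ s∈ → two-summands (B⊆A (proj₁ (proj₁ (∈S s∈))))) d∈)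
        (refine⁺ k _ (λ s∈ → two-summands (proj₂ (proj₂ (∈S s∈)))) a∈)
        (refine⁻ k _ (λ s∈ → two-summands (proj₂ (proj₂ (∈S s∈)))) b∈)

    -- A point of `B²` collides with itself for every `r`, two distinct points for at most one. The
    -- collisions over all of `Gs` thus number at most `|B|² (|Gs| + |B|²) ≤ 2 |Gs| |B|²`, so some
    -- `r` has at most `2 |B|²`. Cauchy-Schwarz then gives `|B|² / 2` values, and `slope-bound`
    -- applies to their representatives.
    slopes-rich : (Gs : List (Fin q)) → Unique Gs → (∀ {g} → g ∈ Gs → Slope g) →
      1 ≤ length Gs → length B * length B ≤ length Gs →
      Q * Q * Q * Q * (length B * length B) ≤ 2 * (κ * κ * κ * κ * length Z)
    slopes-rich Gs Gs-unique Gs-slopes Gs-nonempty B²≤Gs with argmin-≤-∑ Gs (λ r → collisions _≟_ (λ s → proj₁ s ⊕ r ⊗ proj₂ s) B²)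
    ... | inj₁ e = ⊥-elim (<-irrefl (sym e) Gs-nonempty)
    ... | inj₂ (r , r∈ , le) = begin
      Q * Q * Q * Q * (length B * length B)        ≤⟨ *-monoʳ-≤ (Q * Q * Q * Q) many-reps ⟩
      Q * Q * Q * Q * (2 * length reps)            ≡⟨ solve 2 (λ q l → q :* (con 2 :* l) := con 2 :* (q :* l)) refl (Q * Q * Q * Q) (length reps) ⟩
      2 * (Q * Q * Q * Q * length reps)            ≤⟨ *-monoʳ-≤ 2 (slope-bound (Gs-slopes r∈) reps-unique proj₁ proj₂ _
                                                        (λ s∈ → two-summands (B⊆A (proj₁ (in-B s∈)))) (λ s∈ → B⊆A (proj₂ (in-B s∈)))
                                                        (Unique-map⇒injective map-unique)) ⟩
      2 * (κ * κ * κ * κ * length Z)               ∎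
      where
      open ≤-Reasoning
      open +-*-Solver
      φ : Fin q → Fin q × Fin q → Fin q
      φ r (x , y) = x ⊕ r ⊗ y
      open Transversal (transversal _≟_ (φ r) B²)
      in-B : ∀ {s} → s ∈ reps → proj₁ s ∈ B × proj₂ s ∈ B
      in-B s∈ = ∈-cartesianProduct⁻ B B (reps⊆ s∈)
      reps-unique : Unique reps
      reps-unique = Unique.map⁻ map-unique
      m = length B²
      l = length Gs
      _≟₂_ : DecidableEquality (Fin q × Fin q)
      _≟₂_ = ≡-dec _≟_ _≟_
      few-slopes : ∀ p p′ → ∑ Gs (λ r → 𝟙 (φ r p ≟ φ r p′)) ≤ l * 𝟙 (p ≟₂ p′) + 1
      few-slopes p@(x , y) p′@(x′ , y′) with p ≟₂ p′
      ... | yes _ = ≤-trans (≤-trans (∑-mono Gs (λ {r} _ → 𝟙-mono (φ r p ≟ φ r p′) (yes refl) (λ _ → refl {x = p})))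
                      (≤-reflexive (∑-const Gs 1))) (m≤m+n _ 1)
      ... | no p≢p′ = ≤-trans (∑-unique-≤ (λ r → φ r p ≟ φ r p′) (yes refl) Gs-unique
                        (λ {r} {r′} _ _ e e′ → slope-unique (y≢y′ {r} e) (commute e) (commute e′)) (λ _ _ → refl {x = p}))
                        (m≤n+m 1 (l * 0))
        where
        commute : ∀ {r} → x ⊕ r ⊗ y ≡ x′ ⊕ r ⊗ y′ → r ⊗ y ⊕ x ≡ r ⊗ y′ ⊕ x′
        commute {r} e = trans (⊕-comm (r ⊗ y) x) (trans e (⊕-comm x′ (r ⊗ y′)))
        y≢y′ : ∀ {r} → x ⊕ r ⊗ y ≡ x′ ⊕ r ⊗ y′ → y ≢ y′
        y≢y′ {r} e refl = p≢p′ (cong (_, y) (⊕-cancelʳ (r ⊗ y) x x′ e))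
      few-collisions : collisions _≟_ (φ r) B² ≤ 2 * m
      few-collisions = *-cancelˡ-≤ l {{>-nonZero Gs-nonempty}} (begin
        l * collisions _≟_ (φ r) B²                                        ≤⟨ le ⟩
        ∑ Gs (λ r → ∑ B² λ p → ∑ B² λ p′ → 𝟙 (φ r p ≟ φ r p′))             ≡⟨ trans (∑-swap Gs B² _) (∑-cong B² λ p → ∑-swap Gs B² _) ⟩
        ∑ B² (λ p → ∑ B² λ p′ → ∑ Gs λ r → 𝟙 (φ r p ≟ φ r p′))             ≤⟨ ∑-mono B² (λ {p} _ → ∑-mono B² λ {p′} _ → few-slopes p p′) ⟩
        ∑ B² (λ p → ∑ B² λ p′ → l * 𝟙 (p ≟₂ p′) + 1)                       ≤⟨ ∑-mono B² (λ {p} _ → row p) ⟩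
        ∑ B² (λ _ → l + m)                                                 ≡⟨ ∑-const B² (l + m) ⟩
        m * (l + m)                                                        ≤⟨ *-monoʳ-≤ m (+-monoʳ-≤ l (≤-trans (≤-reflexive (length-cartesianProduct B B)) B²≤Gs)) ⟩
        m * (l + l)                                                        ≡⟨ solve 2 (λ m l → m :* (l :+ l) := l :* (con 2 :* m)) refl m l ⟩
        l * (2 * m)                                                        ∎)
        where
        row : ∀ p → ∑ B² (λ p′ → l * 𝟙 (p ≟₂ p′) + 1) ≤ l + m
        row p = begin
          ∑ B² (λ p′ → l * 𝟙 (p ≟₂ p′) + 1)               ≡⟨ ∑-+ B² _ (λ _ → 1) ⟩
          ∑ B² (λ p′ → l * 𝟙 (p ≟₂ p′)) + ∑ B² (λ _ → 1)  ≡⟨ cong₂ _+_ (∑-*ˡ B² l _) (∑-1 B²) ⟩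
          l * ∑ B² (λ p′ → 𝟙 (p ≟₂ p′)) + m               ≤⟨ +-monoˡ-≤ m (*-monoʳ-≤ l (∑-unique-≤ (λ p′ → p ≟₂ p′) (yes refl) B²-unique
                                                              (λ _ _ e e′ → trans (sym e) e′) (λ _ _ → refl {x = p}))) ⟩
          l * 1 + m                                       ≡⟨ cong (_+ m) (*-identityʳ l) ⟩
          l + m                                           ∎
      many-reps : length B * length B ≤ 2 * length reps
      many-reps = subst (_≤ 2 * length reps) (length-cartesianProduct B B) (m*m≤m*k⇒m≤k (begin
        m * m                                                        ≤⟨ length²≤unique-collisions _≟_ (φ r) B² map-unique covers ⟩
        length (map (φ r) reps) * collisions _≟_ (φ r) B²            ≤⟨ *-mono-≤ (≤-reflexive (length-map (φ r) reps)) few-collisions ⟩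
        length reps * (2 * m)                                        ≡⟨ solve 2 (λ k m → k :* (con 2 :* m) := m :* (con 2 :* k)) refl (length reps) m ⟩
        m * (2 * length reps)                                        ∎))

    -- The subfield of multipliers

    module Stabilizer (add-one : ∀ {ρ} → Slope ρ → Slope (1# ⊕ ρ))
                      (multiply : ∀ {b ρ} → b ∈ B → Slope ρ → Slope (b ⊗ ρ)) where

      ∈B⇒≢0 : ∀ {b} → b ∈ B → b ≢ 0#
      ∈B⇒≢0 b∈ refl = 0∉B b∈

      Slope-0 : Slope 0#
      Slope-0 = b₀ , b₀ , b₀ , b₁ , b₀∈B , b₀∈B , b₀∈B , b₁∈B , b₀≢b₁ ,
        cong (_⊕ b₀) (trans (⊗-zeroˡ b₀) (sym (⊗-zeroˡ b₁)))

      Slope-⊖ : ∀ {ρ} → Slope ρ → Slope (⊖ ρ)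
      Slope-⊖ {ρ} (a , b , c , d , a∈ , b∈ , c∈ , d∈ , c≢d , e) =
        b , a , c , d , b∈ , a∈ , c∈ , d∈ , c≢d , ⊕-cancelʳ (ρ ⊗ c ⊕ ρ ⊗ d) _ _ (begin
          ⊖ ρ ⊗ c ⊕ a ⊕ (ρ ⊗ c ⊕ ρ ⊗ d)    ≡⟨ S.solve 5 (λ n ρ a c d → n S.:* c S.:+ a S.:+ (ρ S.:* c S.:+ ρ S.:* d) S.:= (ρ S.:+ n) S.:* c S.:+ (ρ S.:* d S.:+ a)) refl (⊖ ρ) ρ a c d ⟩
          (ρ ⊕ ⊖ ρ) ⊗ c ⊕ (ρ ⊗ d ⊕ a)      ≡⟨ cong₂ _⊕_ (trans (vanish c) (sym (vanish d))) (sym e) ⟩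
          (ρ ⊕ ⊖ ρ) ⊗ d ⊕ (ρ ⊗ c ⊕ b)      ≡⟨ S.solve 5 (λ n ρ b c d → n S.:* d S.:+ b S.:+ (ρ S.:* c S.:+ ρ S.:* d) S.:= (ρ S.:+ n) S.:* d S.:+ (ρ S.:* c S.:+ b)) refl (⊖ ρ) ρ b c d ⟨
          ⊖ ρ ⊗ d ⊕ b ⊕ (ρ ⊗ c ⊕ ρ ⊗ d)    ∎)
        where
        open ≡-Reasoning
        vanish : ∀ x → (ρ ⊕ ⊖ ρ) ⊗ x ≡ 0#
        vanish x = trans (cong (_⊗ x) (⊖-inverseʳ ρ)) (⊗-zeroˡ x)

      Period : Fin q → Set
      Period k = ∀ ρ → Slope ρ → Slope (k ⊕ ρ)

      Period? : Decidable Period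
      Period? k = Fin.all? λ ρ → Slope? ρ →-dec Slope? (k ⊕ ρ)

      Period-0 : Period 0#
      Period-0 ρ s = subst Slope (sym (⊕-identityˡ ρ)) s

      Period-⊕ : ∀ {k l} → Period k → Period l → Period (k ⊕ l)
      Period-⊕ {k} {l} pk pl ρ s = subst Slope (sym (⊕-assoc k l ρ)) (pk _ (pl ρ s))

      -- The slopes are symmetric about 0, and `- k + ρ = - (k + (- ρ))`.
      Period-⊖ : ∀ {k} → Period k → Period (⊖ k)
      Period-⊖ {k} pk ρ s = subst Slope
        (trans (sym (-‿+-comm k (⊖ ρ))) (cong (⊖ k ⊕_) (-‿involutive ρ)))
        (Slope-⊖ (pk _ (Slope-⊖ s)))

      -- `b k + ρ = b (k + b⁻¹ ρ)`, and by finiteness the slopes are stable under `b⁻¹` as well.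
      Period-⊗ : ∀ {b k} → b ∈ B → Period k → Period (b ⊗ k)
      Period-⊗ {b} {k} b∈ pk ρ s = subst Slope
        (trans (⊗-distribˡ-⊕ b k (b ⁻¹ ⊗ ρ)) (cong (b ⊗ k ⊕_) (⁻¹-cancelʳ ρ (∈B⇒≢0 b∈))))
        (multiply b∈ (pk _ (stable-⁻¹ Slope? (∈B⇒≢0 b∈) (multiply b∈) s)))

      Multiplier : Fin q → Set
      Multiplier u = ∀ k → Period k → Period (u ⊗ k)

      Multiplier? : Decidable Multiplier
      Multiplier? u = Fin.all? λ k → Period? k →-dec Period? (u ⊗ k)

      -- By `add-one`, 1 is a period; hence so is `u`, and it carries the slope 0 to `u`.
      Multiplier⇒Slope : ∀ {u} → Multiplier u → Slope u
      Multiplier⇒Slope {u} mu = subst Slope (trans (⊕-identityʳ _) (⊗-identityʳ u)) (mu 1# (λ _ → add-one) 0# Slope-0)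

      multipliers : Subset q
      multipliers = Vec.tabulate (does ∘ Multiplier?)

      ∈⇒Multiplier : ∀ {u} → u ∈ˢ multipliers → Multiplier u
      ∈⇒Multiplier = ∈-tabulate⁻ Multiplier?

      Multiplier⇒∈ : ∀ {u} → Multiplier u → u ∈ˢ multipliers
      Multiplier⇒∈ = ∈-tabulate⁺ Multiplier?

      -- The multipliers of an additive group form a ring; closure under inverses comes from
      -- finiteness, through `stable-⁻¹`.
      multipliers-subfield : IsSubfield F multipliers
      multipliers-subfield = record
        { zero∈ = Multiplier⇒∈ λ k _ → subst Period (sym (⊗-zeroˡ k)) Period-0
        ; one∈ = Multiplier⇒∈ λ k → subst Period (sym (⊗-identityˡ k))
        ; +-closed = λ {u} {v} u∈ v∈ → Multiplier⇒∈ λ k pk → subst Period (sym (⊗-distribʳ-⊕ k u v))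
            (Period-⊕ (∈⇒Multiplier u∈ k pk) (∈⇒Multiplier v∈ k pk))
        ; *-closed = λ {u} {v} u∈ v∈ → Multiplier⇒∈ λ k pk → subst Period (sym (⊗-assoc u v k))
            (∈⇒Multiplier u∈ _ (∈⇒Multiplier v∈ k pk))
        ; neg-closed = λ {u} u∈ → Multiplier⇒∈ λ k pk → subst Period (-‿distribˡ-* u k) (Period-⊖ (∈⇒Multiplier u∈ k pk))
        ; inv-closed = λ u∈ u≢0 → Multiplier⇒∈ λ k → stable-⁻¹ Period? u≢0 (∈⇒Multiplier u∈ _) }

      B⊆multipliers : ∀ {b} → b ∈ B → b ∈ˢ multipliers
      B⊆multipliers b∈ = Multiplier⇒∈ λ _ → Period-⊗ b∈

    -- Over a finite field a search decides whether the slopes are closed under both operations. A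
    -- failure supplies the witness for an escape; otherwise `multipliers` is a subfield of slopes
    -- containing `B`, and `small` makes it large enough for `slopes-rich`.
    bound : (∀ G → IsSubfield F G → (∀ {b} → b ∈ B → b ∈ˢ G) → length B * length B ≤ ∣ G ∣) →
      Dichotomy P Q (length B) (length Z)
    bound small with Fin.any? (λ ρ → Slope? ρ ×-dec ¬? (Slope? (1# ⊕ ρ)))
    -- The factor 2 in the first alternative is slack here; `slopes-rich` is what needs it.
    ... | yes (ρ , s , ¬s) = inj₁ (≤-trans (successor-escapes s ¬s) (m≤n*m _ 2))
    ... | no ¬successor with Fin.any? (λ β → Fin.any? λ ρ → (β ∈? B) ×-dec Slope? ρ ×-dec ¬? (Slope? (β ⊗ ρ)))
    ... | yes (β , ρ , β∈ , s , ¬s) = inj₂ (multiple-escapes β∈ s ¬s)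
    ... | no ¬multiple = inj₁ (slopes-rich (elements multipliers) (elements-unique multipliers)
          (Multiplier⇒Slope ∘ ∈⇒Multiplier ∘ ∈-elements⁻)
          (subst (1 ≤_) (∑-1 (elements multipliers)) (∑-member (elements multipliers) (λ _ → 1)
            (∈-elements⁺ (IsSubfield.zero∈ multipliers-subfield))))
          (subst (length B * length B ≤_) (sym (length-elements multipliers)) (small multipliers multipliers-subfield B⊆multipliers)))
      where
      open Stabilizer
        (λ {ρ} s → decidable-stable (Slope? (1# ⊕ ρ)) λ ¬s → ¬successor (ρ , s , ¬s))
        (λ {β} {ρ} β∈ s → decidable-stable (Slope? (β ⊗ ρ)) λ ¬s → ¬multiple (β , ρ , β∈ , s , ¬s))

Unique-++⁻ʳ : (xs : List X) {ys : List X} → Unique (xs ++ ys) → Unique ys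
Unique-++⁻ʳ []       u       = u
Unique-++⁻ʳ (x ∷ xs) (_ ∷ u) = Unique-++⁻ʳ xs u

-- Exponents and constants

private
  -- Recurses as `_^_` does, so that its interpretation agrees with the literal power.
  pow : ∀ {m} → +-*-Solver.Polynomial m → ℕ → +-*-Solver.Polynomial m
  pow p zero    = +-*-Solver.con 1
  pow p (suc e) = p +-*-Solver.:* pow p e

-- The 8 is the 2 of `Dichotomy` times the 4 from `n² ≤ 4 l²`.
first-alternative : ∀ k K n R N l → 8 * k ^ 4 ≤ K → n ≤ 2 * l →
  (n * n) * (n * n) * (n * n) * (n * n) * (l * l) ≤ 2 * ((k * R * N) * (k * R * N) * (k * R * N) * (k * R * N) * N) →
  n ^ 10 ≤ K * (N ^ 5 * R ^ 4)
first-alternative k K n R N l k≤K n≤2l h = begin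
  n ^ 10                                                              ≡⟨ solve 1 (λ n → pow n 10 := (n :* n) :* (n :* n) :* (n :* n) :* (n :* n) :* (n :* n)) refl n ⟩
  (n * n) * (n * n) * (n * n) * (n * n) * (n * n)                     ≤⟨ *-monoʳ-≤ ((n * n) * (n * n) * (n * n) * (n * n)) (*-mono-≤ n≤2l n≤2l) ⟩
  (n * n) * (n * n) * (n * n) * (n * n) * (2 * l * (2 * l))           ≡⟨ solve 2 (λ m l → m :* (con 2 :* l :* (con 2 :* l)) := con 4 :* (m :* (l :* l))) refl ((n * n) * (n * n) * (n * n) * (n * n)) l ⟩
  4 * ((n * n) * (n * n) * (n * n) * (n * n) * (l * l))               ≤⟨ *-monoʳ-≤ 4 h ⟩
  4 * (2 * ((k * R * N) * (k * R * N) * (k * R * N) * (k * R * N) * N)) ≡⟨ solve 3 (λ k r n → con 4 :* (con 2 :* ((k :* r :* n) :* (k :* r :* n) :* (k :* r :* n) :* (k :* r :* n) :* n)) := (con 8 :* pow k 4) :* (pow n 5 :* pow r 4)) refl k R N ⟩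
  (8 * k ^ 4) * (N ^ 5 * R ^ 4)                                       ≤⟨ *-monoˡ-≤ (N ^ 5 * R ^ 4) k≤K ⟩
  K * (N ^ 5 * R ^ 4)                                                 ∎
  where
  open ≤-Reasoning
  open +-*-Solver

second-alternative : ∀ k K n R N → k ^ 5 ≤ K →
  (n * n) * (n * n) * (n * n) * ((n * n) * (n * n)) ≤ (k * R) * (k * R) * ((k * R * N) * (k * R * N) * (k * R * N)) * N →
  n ^ 10 ≤ K * (N ^ 4 * R ^ 5)
second-alternative k K n R N k≤K h = begin
  n ^ 10                                                   ≡⟨ solve 1 (λ n → pow n 10 := (n :* n) :* (n :* n) :* (n :* n) :* ((n :* n) :* (n :* n))) refl n ⟩
  (n * n) * (n * n) * (n * n) * ((n * n) * (n * n))        ≤⟨ h ⟩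
  (k * R) * (k * R) * ((k * R * N) * (k * R * N) * (k * R * N)) * N
                                                           ≡⟨ solve 3 (λ k r n → (k :* r) :* (k :* r) :* ((k :* r :* n) :* (k :* r :* n) :* (k :* r :* n)) :* n := pow k 5 :* (pow n 4 :* pow r 5)) refl k R N ⟩
  k ^ 5 * (N ^ 4 * R ^ 5)                                  ≤⟨ *-monoˡ-≤ (N ^ 4 * R ^ 5) k≤K ⟩
  K * (N ^ 4 * R ^ 5)                                      ∎
  where
  open ≤-Reasoning
  open +-*-Solver

Alternatives : (K n N R : ℕ) → Set
Alternatives K n N R = (n ^ 10 ≤ K * (N ^ 5 * R ^ 4)) ⊎ (n ^ 10 ≤ K * (N ^ 4 * R ^ 5))

-- The popularity is `Q / P = n² / (16 R)`. The second alternative costs `16 ^ 5`, which exceeds the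
-- `8 * 16 ^ 4` of the first.
Dichotomy⇒Alternatives : ∀ K n N R l → 16 ^ 5 ≤ K → n ≤ 2 * l → Dichotomy (16 * R) (n * n) l N → Alternatives K n N R
Dichotomy⇒Alternatives K n N R l le n≤2l (inj₁ h) =
  inj₁ (first-alternative 16 K n R N l (≤-trans (≤ᵇ⇒≤ (8 * 16 ^ 4) (16 ^ 5) _) le) n≤2l h)
Dichotomy⇒Alternatives K n N R l le n≤2l (inj₂ h) = inj₂ (second-alternative 16 K n R N le h)

-- Covers the sets whose core has fewer than two elements, where no slope need exist.
small-alternative : ∀ K n N R → 2 ^ 10 ≤ K → n ≤ 2 → 1 ≤ N → 1 ≤ R → n ^ 10 ≤ K * (N ^ 5 * R ^ 4)
small-alternative K n N R le n≤2 1≤N 1≤R = begin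
  n ^ 10                  ≤⟨ ^-monoˡ-≤ 10 n≤2 ⟩
  2 ^ 10                  ≤⟨ le ⟩
  K                       ≡⟨ *-identityʳ K ⟨
  K * (1 ^ 5 * 1 ^ 4)     ≤⟨ *-monoʳ-≤ K (*-mono-≤ (^-monoˡ-≤ 5 1≤N) (^-monoˡ-≤ 4 1≤R)) ⟩
  K * (N ^ 5 * R ^ 4)     ∎
  where open ≤-Reasoning

Alternatives⇒max : ∀ K n N R → Alternatives K n N R → n ^ 10 ≤ K * (N ⊔ R) ^ 9
Alternatives⇒max K n N R (inj₁ h) = ≤-trans h (*-monoʳ-≤ K (≤-trans
  (*-mono-≤ (^-monoˡ-≤ 5 (m≤m⊔n N R)) (^-monoˡ-≤ 4 (m≤n⊔m N R))) (≤-reflexive (sym (^-distribˡ-+-* (N ⊔ R) 5 4)))))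
Alternatives⇒max K n N R (inj₂ h) = ≤-trans h (*-monoʳ-≤ K (≤-trans
  (*-mono-≤ (^-monoˡ-≤ 4 (m≤m⊔n N R)) (^-monoˡ-≤ 5 (m≤n⊔m N R))) (≤-reflexive (sym (^-distribˡ-+-* (N ⊔ R) 4 5)))))

-- The base point and the popular core

Hypothesis : {q : ℕ} → FiniteField q → Subset q → Set
Hypothesis {q} F A = (G : Subset q) → IsSubfield F G → (c : Fin q) → (∣ _∩scaled_,_ F A c G ∣ ^ 2 ≤ ∣ G ∣) ⊎ (8 * ∣ _∩scaled_,_ F A c G ∣ ≤ ∣ A ∣)

module Main {q : ℕ} (F : FiniteField q) (A : Subset q) (0∉A : NonzeroSet F A) (hyp : Hypothesis F A)
            (K : ℕ) (16⁵≤K : 16 ^ 5 ≤ K) where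
  open FiniteField F renaming (_+_ to infixl 6 _⊕_; _*_ to infixl 7 _⊗_; -_ to infix 8 ⊖_; _⁻¹ to infix 8 _⁻¹)
  open FieldLemmas F

  As = elements A
  Rs = elements (ratioSet F A)
  Zs = elements (fourfoldSum F A)
  n = length As
  R = length Rs
  N = length Zs

  ratio∈ : ∀ {a b} → a ∈ As → b ∈ As → a ⊗ b ⁻¹ ∈ Rs
  ratio∈ {a} {b} a∈ b∈ = ∈-elements⁺ (∈-tabulate⁺
    (λ x → Fin.any? λ a → Fin.any? λ b → (a Subset.∈? A) ×-dec (b Subset.∈? A) ×-dec (x Fin.≟ (a ⊗ b ⁻¹)))
    (a , b , ∈-elements⁻ a∈ , ∈-elements⁻ b∈ , refl))

  sum∈ : ∀ {a b c d} → a ∈ As → b ∈ As → c ∈ As → d ∈ As → a ⊕ b ⊕ c ⊕ d ∈ Zs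
  sum∈ {a} {b} {c} {d} a∈ b∈ c∈ d∈ = ∈-elements⁺ (∈-tabulate⁺
    (λ x → Fin.any? λ a₁ → Fin.any? λ a₂ → Fin.any? λ a₃ → Fin.any? λ a₄ →
      (a₁ Subset.∈? A) ×-dec (a₂ Subset.∈? A) ×-dec (a₃ Subset.∈? A) ×-dec (a₄ Subset.∈? A) ×-dec
      (x Fin.≟ (((a₁ ⊕ a₂) ⊕ a₃) ⊕ a₄)))
    (a , b , c , d , ∈-elements⁻ a∈ , ∈-elements⁻ b∈ , ∈-elements⁻ c∈ , ∈-elements⁻ d∈ , refl))

  ∈As⇒≢0 : ∀ {a} → a ∈ As → a ≢ 0#
  ∈As⇒≢0 a∈ refl = 0∉A (∈-elements⁻ a∈)

  -- Number of representations of `s` as a ratio of two elements of `A`.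
  multiplicity : Fin q → ℕ
  multiplicity s = ∑ As (λ x → 𝟙 (x ⊗ s ∈? As))

  -- Multiplicity below `n² / (4R)`, a quarter of its mean over the ratio set; this is the
  -- low-degree condition of `removed-≤` for `P = 8R`, `Q = n²`.
  Poor? : Decidable (λ s → 8 * R * multiplicity s < 2 * (n * n))
  Poor? s = 8 * R * multiplicity s <? 2 * (n * n)

  ∈⇒1≤length : {x : X} {xs : List X} → x ∈ xs → 1 ≤ length xs
  ∈⇒1≤length {xs = _ ∷ _} _ = s≤s z≤n

  -- There are at most `R` poor ratios, each represented by at most `n² / (4R)` pairs. The element
  -- `a` ensures that `R` is positive.
  few-poor-pairs : ∀ {a} → a ∈ As → 4 * ∑ As (λ x₀ → ∑ As λ u → 𝟙 (Poor? (u ⊗ x₀ ⁻¹))) ≤ n * n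
  few-poor-pairs a∈ = *-cancelˡ-≤ (2 * R) {{>-nonZero 2R>0}} (begin
    2 * R * (4 * ∑ As (λ x₀ → ∑ As λ u → 𝟙 (Poor? (u ⊗ x₀ ⁻¹))))
      ≡⟨ solve 2 (λ r t → con 2 :* r :* (con 4 :* t) := con 8 :* r :* t) refl R _ ⟩
    8 * R * ∑ As (λ x₀ → ∑ As λ u → 𝟙 (Poor? (u ⊗ x₀ ⁻¹)))
      ≤⟨ *-monoʳ-≤ (8 * R) (∑-mono As λ {x₀} x₀∈ → ∑-mono As λ {u} u∈ → split-by-slope x₀∈ u∈) ⟩
    8 * R * ∑ As (λ x₀ → ∑ As λ u → ∑ Rs λ s → 𝟙 (on-poor-line? s x₀ u))
      ≡⟨ cong (8 * R *_) (trans (∑-cong As λ x₀ → ∑-swap As Rs _) (∑-swap As Rs _)) ⟩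
    8 * R * ∑ Rs (λ s → ∑ As λ x₀ → ∑ As λ u → 𝟙 (on-poor-line? s x₀ u))
      ≡⟨ ∑-*ˡ Rs (8 * R) _ ⟨
    ∑ Rs (λ s → 8 * R * ∑ As λ x₀ → ∑ As λ u → 𝟙 (on-poor-line? s x₀ u))
      ≤⟨ ∑-mono Rs (λ {s} _ → poor-line s (Poor? s)) ⟩
    ∑ Rs (λ _ → 2 * (n * n))
      ≡⟨ ∑-const Rs _ ⟩
    R * (2 * (n * n))
      ≡⟨ solve 2 (λ r m → r :* (con 2 :* m) := con 2 :* r :* m) refl R (n * n) ⟩
    2 * R * (n * n) ∎)
    where
    open ≤-Reasoning
    open +-*-Solver
    2R>0 : 0 < 2 * R
    2R>0 = ≤-trans (∈⇒1≤length (ratio∈ a∈ a∈)) (m≤n*m R 2)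
    on-poor-line? : ∀ s x₀ u → Dec (8 * R * multiplicity s < 2 * (n * n) × u ⊗ x₀ ⁻¹ ≡ s)
    on-poor-line? s x₀ u = Poor? s ×-dec ((u ⊗ x₀ ⁻¹) ≟ s)
    split-by-slope : ∀ {x₀ u} → x₀ ∈ As → u ∈ As → 𝟙 (Poor? (u ⊗ x₀ ⁻¹)) ≤ ∑ Rs (λ s → 𝟙 (on-poor-line? s x₀ u))
    split-by-slope {x₀} {u} x₀∈ u∈ = ≤-trans
      (𝟙-mono (Poor? (u ⊗ x₀ ⁻¹)) (on-poor-line? (u ⊗ x₀ ⁻¹) x₀ u) (_, refl))
      (∑-member Rs (λ s → 𝟙 (on-poor-line? s x₀ u)) (ratio∈ u∈ x₀∈))
    divide : ∀ {x₀ u s} → x₀ ∈ As → u ⊗ x₀ ⁻¹ ≡ s → u ≡ x₀ ⊗ s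
    divide {x₀} {u} x₀∈ refl = sym (trans (cong (x₀ ⊗_) (⊗-comm u (x₀ ⁻¹))) (⁻¹-cancelʳ u (∈As⇒≢0 x₀∈)))
    poor-line : ∀ s (poor? : Dec (8 * R * multiplicity s < 2 * (n * n))) →
                8 * R * ∑ As (λ x₀ → ∑ As λ u → 𝟙 (poor? ×-dec ((u ⊗ x₀ ⁻¹) ≟ s))) ≤ 2 * (n * n)
    poor-line s (no _) = ≤-trans (≤-reflexive (trans (cong (8 * R *_)
        (trans (∑-cong As λ _ → trans (∑-const As 0) (*-zeroʳ n)) (trans (∑-const As 0) (*-zeroʳ n)))) (*-zeroʳ (8 * R)))) z≤n
    poor-line s (yes poor) = ≤-trans (*-monoʳ-≤ (8 * R) (∑-mono As λ {x₀} x₀∈ →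
        ∑-unique-≤ (λ u → (u ⊗ x₀ ⁻¹) ≟ s) (x₀ ⊗ s ∈? As) (elements-unique A)
          (λ _ _ e e′ → trans (divide x₀∈ e) (sym (divide x₀∈ e′)))
          (λ u∈ e → subst (_∈ As) (divide x₀∈ e) u∈))) (<⇒≤ poor)

  rich-base-point : n ≡ 0 ⊎ ∃ λ x₀ → x₀ ∈ As × 4 * ∑ As (λ u → 𝟙 (Poor? (u ⊗ x₀ ⁻¹))) ≤ n
  rich-base-point with argmin-≤-∑ As (λ x₀ → ∑ As (λ u → 𝟙 (Poor? (u ⊗ x₀ ⁻¹))))
  ... | inj₁ e = inj₁ e
  ... | inj₂ (x₀ , x₀∈ , le) = inj₂ (x₀ , x₀∈ , *-cancelˡ-≤ n {{>-nonZero (∈⇒1≤length x₀∈)}} (begin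
    n * (4 * t)      ≡⟨ solve 2 (λ n t → n :* (con 4 :* t) := con 4 :* (n :* t)) refl n t ⟩
    4 * (n * t)      ≤⟨ *-monoʳ-≤ 4 le ⟩
    4 * ∑ As (λ x₀ → ∑ As (λ u → 𝟙 (Poor? (u ⊗ x₀ ⁻¹)))) ≤⟨ few-poor-pairs x₀∈ ⟩
    n * n            ∎))
    where
    open ≤-Reasoning
    open +-*-Solver
    t = ∑ As (λ u → 𝟙 (Poor? (u ⊗ x₀ ⁻¹)))

  small : ∀ {a} → a ∈ As → n ≤ 2 → Alternatives K n N R
  small a∈ n≤2 = inj₁ (small-alternative K n N R (≤-trans (≤ᵇ⇒≤ (2 ^ 10) (16 ^ 5) _) 16⁵≤K) n≤2
    (∈⇒1≤length (sum∈ a∈ a∈ a∈ a∈)) (∈⇒1≤length (ratio∈ a∈ a∈)))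

  module BasePoint {x₀ : Fin q} (x₀∈ : x₀ ∈ As) (few-poor : 4 * ∑ As (λ u → 𝟙 (Poor? (u ⊗ x₀ ⁻¹))) ≤ n) where

    x₀≢0 : x₀ ≢ 0#
    x₀≢0 = ∈As⇒≢0 x₀∈

    -- The degree of `x` in `As` is `multiplicity (x ⊗ x₀ ⁻¹)`, so `few-poor` bounds the number of
    -- low-degree vertices.
    adj : Fin q → Fin q → ℕ
    adj x y = 𝟙 (y ⊗ (x ⊗ x₀ ⁻¹) ∈? As)

    adj-sym : ∀ x y → adj x y ≡ adj y x
    adj-sym x y = cong (λ z → 𝟙 (z ∈? As))
      (S.solve 3 (λ x y i → y S.:* (x S.:* i) S.:= x S.:* (y S.:* i)) refl x y (x₀ ⁻¹))

    instance
      n²-nonZero : NonZero (n * n)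
      n²-nonZero = >-nonZero (*-mono-≤ (∈⇒1≤length x₀∈) (∈⇒1≤length x₀∈))

    peeled : Core adj (8 * R) (n * n) As
    peeled = peel adj adj-sym (8 * R) (n * n) n As ≤-refl

    open Core peeled renaming (removed to W; core to C)

    C-unique : Unique C
    C-unique = Unique-++⁻ʳ W (PermutationSetoid.Unique-resp-↭ (setoid (Fin q)) (↭⇒↭ₛ split) (elements-unique A))

    C⊆As : ∀ {x} → x ∈ C → x ∈ As
    C⊆As x∈ = ∈-resp-↭ (↭-sym split) (∈-++⁺ʳ W x∈)

    -- At most `2u` vertices are removed and `4u ≤ n`, so at least half of `A` survives.
    n≤2∣C∣ : n ≤ 2 * length C
    n≤2∣C∣ = +-cancelˡ-≤ n n (2 * length C) (begin
      n + n                          ≡⟨ cong₂ _+_ len len ⟩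
      w + c + (w + c)                ≡⟨ solve 2 (λ w c → w :+ c :+ (w :+ c) := con 2 :* w :+ con 2 :* c) refl w c ⟩
      2 * w + 2 * c                  ≤⟨ +-monoˡ-≤ (2 * c) (*-monoʳ-≤ 2 (removed-≤ adj (8 * R) (n * n) peeled)) ⟩
      2 * (2 * u) + 2 * c            ≡⟨ cong (_+ 2 * c) (*-assoc 2 2 u) ⟨
      4 * u + 2 * c                  ≤⟨ +-monoˡ-≤ (2 * c) few-poor ⟩
      n + 2 * c                      ∎)
      where
      open ≤-Reasoning
      open +-*-Solver
      w = length W
      c = length C
      u = ∑ As (λ u → 𝟙 (Poor? (u ⊗ x₀ ⁻¹)))
      len : n ≡ w + c
      len = trans (↭-length split) (length-++ W)

    -- Division by `x₀` turns the adjacency `y x / x₀ ∈ A` into `σ y ⊗ σ x ∈ σ A`, a condition on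
    -- products.
    σ : Fin q → Fin q
    σ x = x ⊗ x₀ ⁻¹

    unscale : ∀ x → x₀ ⊗ σ x ≡ x
    unscale x = trans (cong (x₀ ⊗_) (⊗-comm x (x₀ ⁻¹))) (⁻¹-cancelʳ x x₀≢0)

    σ-injective : ∀ {x y} → σ x ≡ σ y → x ≡ y
    σ-injective {x} {y} e = trans (sym (unscale x)) (trans (cong (x₀ ⊗_) e) (unscale y))

    B = map σ C

    Popular : Fin q → Set
    Popular b = n * n ≤ 16 * R * length (filter (λ x → b ⊗ x ∈? map σ As) B)

    -- The core degree `Q / (2P)` with `P = 8R`, transported by `σ`; hence the 16.
    popular-σ : ∀ {y} → y ∈ C → Popular (σ y)
    popular-σ {y} y∈ = begin
      n * n                                          ≤⟨ degree y∈ ⟩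
      2 * (8 * R * ∑ C (adj y))                      ≡⟨ solve 2 (λ r t → con 2 :* (con 8 :* r :* t) := con 16 :* r :* t) refl R (∑ C (adj y)) ⟩
      16 * R * ∑ C (adj y)                           ≤⟨ *-monoʳ-≤ (16 * R) (∑-mono C λ {x} _ → 𝟙-mono (x ⊗ σ y ∈? As) (σ y ⊗ σ x ∈? map σ As)
                                                          (λ x∈ → subst (_∈ map σ As) (scale x y) (∈-map⁺ σ x∈))) ⟩
      16 * R * ∑ C (λ x → 𝟙 (σ y ⊗ σ x ∈? map σ As)) ≡⟨ cong (16 * R *_) (trans (length-filter≡∑ _ B) (∑-map σ C _)) ⟨
      16 * R * length (filter (λ x → σ y ⊗ x ∈? map σ As) B) ∎
      where
      open ≤-Reasoning
      open +-*-Solver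
      scale : ∀ x y → σ (x ⊗ σ y) ≡ σ y ⊗ σ x
      scale x y = S.solve 3 (λ x y i → x S.:* (y S.:* i) S.:* i S.:= (y S.:* i) S.:* (x S.:* i)) refl x y (x₀ ⁻¹)

    popular : ∀ {b} → b ∈ B → Popular b
    popular b∈ = let y , y∈ , e = ∈-map⁻ σ b∈ in subst Popular (sym e) (popular-σ y∈)

    sums : ∀ {a b c d} → a ∈ map σ As → b ∈ map σ As → c ∈ map σ As → d ∈ map σ As → a ⊕ b ⊕ c ⊕ d ∈ map σ Zs
    sums a∈ b∈ c∈ d∈ with ∈-map⁻ σ a∈ | ∈-map⁻ σ b∈ | ∈-map⁻ σ c∈ | ∈-map⁻ σ d∈
    ... | a , a∈ , refl | b , b∈ , refl | c , c∈ , refl | d , d∈ , refl = subst (_∈ map σ Zs)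
      (S.solve 5 (λ a b c d i → (a S.:+ b S.:+ c S.:+ d) S.:* i S.:= a S.:* i S.:+ b S.:* i S.:+ c S.:* i S.:+ d S.:* i) refl a b c d (x₀ ⁻¹))
      (∈-map⁺ σ (sum∈ a∈ b∈ c∈ d∈))

    -- `B ⊆ G` puts `C` inside `A ∩ x₀ G`, so `m ≥ |C| ≥ n / 2`. The first alternative of the
    -- hypothesis is the required bound; the second gives `8m ≤ n ≤ 2m`, so `m = 0` and `C` is
    -- empty.
    not-in-subfield : ∀ G → IsSubfield F G → (∀ {b} → b ∈ B → b ∈ˢ G) → length B * length B ≤ ∣ G ∣
    not-in-subfield G isSubfield B⊆G = subst (λ l → l * l ≤ ∣ G ∣) (sym (length-map σ C)) (from-hyp (hyp G isSubfield x₀))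
      where
      m = ∣ _∩scaled_,_ F A x₀ G ∣
      ∣C∣≤m : length C ≤ m
      ∣C∣≤m = ≤-trans (injection⇒length-≤ _≟_ C-unique (elements (_∩scaled_,_ F A x₀ G)) id (λ _ _ → id)
        (λ {x} x∈ → ∈-elements⁺ (∈-tabulate⁺
          (λ x → (x Subset.∈? A) ×-dec Fin.any? (λ g → (g Subset.∈? G) ×-dec (x Fin.≟ (x₀ ⊗ g))))
          (∈-elements⁻ (C⊆As x∈) , σ x , B⊆G (∈-map⁺ σ x∈) , sym (unscale x)))))
        (≤-reflexive (length-elements (_∩scaled_,_ F A x₀ G)))
      from-hyp : m ^ 2 ≤ ∣ G ∣ ⊎ 8 * m ≤ ∣ A ∣ → length C * length C ≤ ∣ G ∣
      from-hyp (inj₁ m²≤) = ≤-trans (*-mono-≤ ∣C∣≤m ∣C∣≤m) (≤-trans (≤-reflexive (cong (m *_) (sym (*-identityʳ m)))) m²≤)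
      from-hyp (inj₂ 8m≤) = ≤-trans (≤-reflexive (cong (λ l → l * l) (n≤0⇒n≡0 (≤-trans ∣C∣≤m m≤0)))) z≤n
        where
        open ≤-Reasoning
        open +-*-Solver
        m≤0 : m ≤ 0
        m≤0 = *-cancelˡ-≤ 6 (+-cancelˡ-≤ (2 * m) _ _ (begin
          2 * m + 6 * m     ≡⟨ solve 1 (λ m → con 2 :* m :+ con 6 :* m := con 8 :* m) refl m ⟩
          8 * m             ≤⟨ 8m≤ ⟩
          ∣ A ∣             ≡⟨ length-elements A ⟨
          n                 ≤⟨ n≤2∣C∣ ⟩
          2 * length C      ≤⟨ *-monoʳ-≤ 2 ∣C∣≤m ⟩
          2 * m             ≡⟨ +-identityʳ (2 * m) ⟨
          2 * m + 6 * 0     ∎))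

    dichotomy : ∀ {c₀ c₁} → c₀ ∈ C → c₁ ∈ C → c₀ ≢ c₁ → Dichotomy (16 * R) (n * n) (length B) (length (map σ Zs))
    dichotomy c₀∈ c₁∈ c₀≢c₁ = SumRatio.Bound.bound F (map σ As) B (map σ Zs) (16 * R) (n * n) sums
      (Unique.map⁺ σ-injective C-unique)
      (λ b∈ → let y , y∈ , e = ∈-map⁻ σ b∈ in subst (_∈ map σ As) (sym e) (∈-map⁺ σ (C⊆As y∈)))
      (λ 0∈ → let y , y∈ , e = ∈-map⁻ σ 0∈ in
        ∈As⇒≢0 (C⊆As y∈) (σ-injective (trans (sym e) (sym (⊗-zeroˡ (x₀ ⁻¹))))))
      popular (∈-map⁺ σ c₀∈) (∈-map⁺ σ c₁∈) (c₀≢c₁ ∘ σ-injective) not-in-subfield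

    conclude : ∀ {c₀ c₁} → c₀ ∈ C → c₁ ∈ C → c₀ ≢ c₁ → Alternatives K n N R
    conclude c₀∈ c₁∈ c₀≢c₁ = Dichotomy⇒Alternatives K n N R (length C) 16⁵≤K n≤2∣C∣
      (subst (λ l → Dichotomy (16 * R) (n * n) l N) (length-map σ C)
        (subst (Dichotomy (16 * R) (n * n) (length B)) (length-map σ Zs) (dichotomy c₀∈ c₁∈ c₀≢c₁)))

    conclusion : Alternatives K n N R
    conclusion = cases C refl
      where
      cases : ∀ D → C ≡ D → Alternatives K n N R
      -- A core with at most one element forces `n ≤ 2`.
      cases []  e = small x₀∈ (≤-trans n≤2∣C∣ (≤-trans (≤-reflexive (cong (λ l → 2 * length l) e)) z≤n))
      cases (_ ∷ []) e = small x₀∈ (≤-trans n≤2∣C∣ (≤-reflexive (cong (λ l → 2 * length l) e)))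
      cases (c₀ ∷ c₁ ∷ D) e = conclude (subst (c₀ ∈_) (sym e) (here refl)) (subst (c₁ ∈_) (sym e) (there (here refl)))
        (All.head (AllPairs.head (subst Unique e C-unique)))

  conclusion : Alternatives K n N R
  conclusion with rich-base-point
  ... | inj₁ n≡0 = inj₁ (subst (λ m → m ^ 10 ≤ K * (N ^ 5 * R ^ 4)) (sym n≡0) z≤n)
  ... | inj₂ (x₀ , x₀∈ , few-poor) = BasePoint.conclusion x₀∈ few-poor

-- The theorem with an explicit constant

alternatives : ∀ K → 16 ^ 5 ≤ K → (q : ℕ) (F : FiniteField q) (A : Subset q) → NonzeroSet F A → Hypothesis F A →
               Alternatives K (∣ A ∣) (∣ fourfoldSum F A ∣) (∣ ratioSet F A ∣)
alternatives K 16⁵≤K q F A 0∉A hyp =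
  subst (λ n → Alternatives K n (∣ fourfoldSum F A ∣) (∣ ratioSet F A ∣)) (length-elements A)
    (subst (λ N → Alternatives K (length (elements A)) N (∣ ratioSet F A ∣)) (length-elements (fourfoldSum F A))
      (subst (Alternatives K (length (elements A)) (length (elements (fourfoldSum F A)))) (length-elements (ratioSet F A))
        (Main.conclusion F A 0∉A hyp K 16⁵≤K)))

theorem3 : (Σ ℕ λ C → NonZero C × ((q : ℕ) (F : FiniteField q) (A : Subset q) → NonzeroSet F A → ((G : Subset q) → IsSubfield F G → (c : Fin q) → (∣ _∩scaled_,_ F A c G ∣ ^ 2 ≤ ∣ G ∣) ⊎ (8 * ∣ _∩scaled_,_ F A c G ∣ ≤ ∣ A ∣)) → (∣ A ∣ ^ 10 ≤ C * (∣ fourfoldSum F A ∣ ^ 5 * ∣ ratioSet F A ∣ ^ 4)) ⊎ (∣ A ∣ ^ 10 ≤ C * (∣ fourfoldSum F A ∣ ^ 4 * ∣ ratioSet F A ∣ ^ 5))))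
    × (Σ ℕ λ C → NonZero C × ((q : ℕ) (F : FiniteField q) (A : Subset q) → NonzeroSet F A → ((G : Subset q) → IsSubfield F G → (c : Fin q) → (∣ _∩scaled_,_ F A c G ∣ ^ 2 ≤ ∣ G ∣) ⊎ (8 * ∣ _∩scaled_,_ F A c G ∣ ≤ ∣ A ∣)) → ∣ A ∣ ^ 10 ≤ C * ((∣ fourfoldSum F A ∣ ⊔ ∣ ratioSet F A ∣) ^ 9)))
theorem3 =
  (16 ^ 5 , _ , alternatives (16 ^ 5) ≤-refl) ,
  (16 ^ 5 , _ , λ q F A 0∉A hyp → Alternatives⇒max (16 ^ 5) (∣ A ∣) (∣ fourfoldSum F A ∣) (∣ ratioSet F A ∣)
    (alternatives (16 ^ 5) ≤-refl q F A 0∉A hyp))
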